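{- Let $n\ge 2$. There exists a bijection $\phi_n:\mathrm{sPF}(K_{n+1})\longrightarrow \mathcal{U}_n$ from the set of spherical $K_{n+1}$-parking functions to the set of uprooted trees on $[n]$ such that \[ \mathrm{sum}(\mathcal{P})=\binom{n}{2}-\kappa(K_n,\phi_n(\mathcal{P}))+1\qquad\text{for all }\mathcal{P}\in \mathrm{sPF}(K_{n+1}). \]
   Context: $\mathbb{N}=\{0,1,2,\dots\}$, $[n]=\{1,\dots,n\}$. $K_{n+1}$ is the complete simple graph on $V=\{0,1,\dots,n\}$ with root $0$, and $K_n=K_{n+1}-\{0\}$ is the complete graph on $[n]$. Spherical parking functions: let $R=\mathbb{K}[x_1,\dots,x_n]$ over a field $\mathbb{K}$. For an undirected loopless graph $G$ on $V$ with $a_{ij}$ edges between $i$ and $j$, and $\emptyset\ne A\subseteq[n]$, put $d_A(i)=\sum_{j\in V\setminus A}a_{ij}$ and $m_A=\prod_{i\in A}x_i^{d_A(i)}$. Let $\mathcal{M}_G=\langle m_A:\emptyset\neq A\subseteq[n]\rangle$ and $\mathcal{M}_G^{(k)}=\langle m_A:\emptyset\ne A\subseteq[n],\ |A|\le k+1\rangle$ for $0\le k\le n-1$. Then $\mathrm{sPF}(G)=\{\mathcal{P}=(p_1,\dots,p_n)\in\mathbb{N}^n:\ \prod_i x_i^{p_i}\in\mathcal{M}_G\setminus\mathcal{M}_G^{(n-2)}\}$, and $\mathrm{sum}(\mathcal{P})=\sum_{i=1}^n p_i$. Uprooted trees: a rooted labelled tree $T$ on vertex set $[n]$ is uprooted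 if its root is larger than all children of the root. $\mathcal{U}_n$ is the set of uprooted trees on $[n]$ (any element of $[n]$ may be the root). $\kappa$-number: let $T$ be a spanning tree of a graph $H$, rooted at $r$. For a non-root vertex $i$, $\mathrm{par}_T(i)$ denotes its parent; $i$ is an ancestor of $j\neq i$ if $i$ lies on the path in $T$ from $r$ to $j$. Then $\kappa(H,T)=\sum |E(\mathrm{par}_T(i),j)|$, the sum over all pairs $(i,j)$ of non-root vertices with $i$ an ancestor of $j$ in $T$ and $i>j$, where $|E(u,v)|$ is the number of edges of $H$ between $u$ and $v$. -}

module Defs where

open import Algebra.Apartness.Bundles using (HeytingField)
open import Data.Bool.Base using (Bool; true; false; if_then_else_)
open import Data.Fin.Base using (Fin; suc; _<_)
open import Data.Fin.Properties using (_≟_; _<?_)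
open import Data.Fin.Subset using (Subset; outside; ∁; Nonempty; ∣_∣)
open import Data.List.Base using (List; []; _∷_; _++_; map; concatMap; foldr)
open import Data.List.Membership.Propositional using (_∈_)
open import Data.List.Relation.Unary.Unique.Propositional using (Unique)
open import Data.Nat.Base using (ℕ; suc; _+_; _∸_; _≤_)
open import Data.Nat.Properties using (+-0-commutativeMonoid)
open import Data.Product.Base using (Σ-syntax; _×_; _,_; proj₁; proj₂)
open import Data.Vec.Base as Vec using (Vec; lookup; tabulate; zipWith)
open import Data.Vec.Properties using (≡-dec)
open import Level using (0ℓ; _⊔_)
open import Relation.Binary.Bundles using (Setoid)
open import Relation.Binary.Definitions using (Decidable)
open import Relation.Binary.PropositionalEquality.Core using (_≡_; _≢_; refl; sym; trans)
open import Relation.Nullary.Decidable.Core using (yes; no; does; ¬?; _×-dec_)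
open import Relation.Nullary.Negation.Core using (¬_; contradiction)

import Algebra.Properties.CommutativeMonoid.Sum +-0-commutativeMonoid as ∑ℕ
import Data.List.Membership.DecPropositional as DecMembership
import Data.Nat.Properties as ℕ

∑ : ∀ {n} → (Fin n → ℕ) → ℕ
∑ = ∑ℕ.sum

-- Loopless undirected multigraphs on {0,…,N-1}, given by edge multiplicities.
record Multigraph (N : ℕ) : Set where
  field
    mult     : Fin N → Fin N → ℕ
    mult-sym : ∀ u v → mult u v ≡ mult v u
    loopless : ∀ u → mult u u ≡ 0

open Multigraph public

complete : ∀ N → Multigraph N
complete N = record { mult = m ; mult-sym = m-sym ; loopless = m-loopless }
  where
  m : Fin N → Fin N → ℕ
  m u v = if does (u ≟ v) then 0 else 1

  m-sym : ∀ u v → m u v ≡ m v u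
  m-sym u v with u ≟ v | v ≟ u
  ... | yes _ | yes _ = refl
  ... | no  _ | no  _ = refl
  ... | yes p | no  q = contradiction (sym p) q
  ... | no  p | yes q = contradiction (sym q) p

  m-loopless : ∀ u → m u u ≡ 0
  m-loopless u with u ≟ u
  ... | yes _ = refl
  ... | no  p = contradiction refl p

-- The polynomial ring K[x₁,…,xₙ].  A polynomial is presented by a finite list
-- of terms (coefficient , exponent vector), possibly with repeated exponents or
-- zero coefficients; two presentations are equal when all coefficients agree.
module PolynomialRing {c ℓ₁ ℓ₂} (K : HeytingField c ℓ₁ ℓ₂) (n : ℕ) where

  private module K = HeytingField K

  Exponent : Set
  Exponent = Vec ℕ n

  Polynomial : Set c
  Polynomial = List (K.Carrier × Exponent)

  coefficient : Polynomial → Exponent → K.Carrier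
  coefficient p e =
    foldr (λ (a , d) s → if does (≡-dec ℕ._≟_ d e) then a K.+ s else s) K.0# p

  infix 4 _≈ₚ_
  _≈ₚ_ : Polynomial → Polynomial → Set ℓ₁
  p ≈ₚ q = ∀ e → coefficient p e K.≈ coefficient q e

  infixl 6 _+ₚ_
  _+ₚ_ : Polynomial → Polynomial → Polynomial
  _+ₚ_ = _++_

  infixl 7 _*ₚ_
  _*ₚ_ : Polynomial → Polynomial → Polynomial
  p *ₚ q = concatMap (λ (a , d) → map (λ (b , e) → a K.* b , zipWith _+_ d e) q) p

  0ₚ : Polynomial
  0ₚ = []

  monomial : Exponent → Polynomial
  monomial e = (K.1# , e) ∷ []

  -- p ∈⟨ g ⟩ : p is a finite combination ∑ qₜ · g iₜ with polynomial
  -- coefficients, i.e. p lies in the ideal generated by the family g.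
  infix 4 _∈⟨_⟩
  _∈⟨_⟩ : ∀ {ι} {I : Set ι} → Polynomial → (I → Polynomial) → Set (c ⊔ ℓ₁ ⊔ ι)
  _∈⟨_⟩ {I = I} p g =
    Σ[ ts ∈ List (Polynomial × I) ] p ≈ₚ foldr (λ (q , i) s → q *ₚ g i +ₚ s) 0ₚ ts

-- The vertex i ∈ [n] is i : Fin n, with the same order; inside
-- V = {0,…,n} = Fin (suc n) it is suc i, and the root is zero.
module _ {n : ℕ} (G : Multigraph (suc n)) where

  d : Subset n → Fin n → ℕ
  d A i = ∑ λ j → if lookup (∁ (outside Vec.∷ A)) j then mult G (suc i) j else 0

  m-exponent : Subset n → Vec ℕ n
  m-exponent A = tabulate λ i → if lookup A i then d A i else 0

module _ {c ℓ₁ ℓ₂} (K : HeytingField c ℓ₁ ℓ₂) {n : ℕ} (G : Multigraph (suc n)) where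

  open PolynomialRing K n

  𝓜-generator : (Σ[ A ∈ Subset n ] Nonempty A) → Polynomial
  𝓜-generator (A , _) = monomial (m-exponent G A)

  𝓜⁽_⁾-generator : (k : ℕ) → (Σ[ A ∈ Subset n ] Nonempty A × ∣ A ∣ ≤ suc k) → Polynomial
  𝓜⁽ k ⁾-generator (A , _) = monomial (m-exponent G A)

  IsSphericalPF : Vec ℕ n → Set (c ⊔ ℓ₁)
  IsSphericalPF p = monomial p ∈⟨ 𝓜-generator ⟩ × ¬ (monomial p ∈⟨ 𝓜⁽ n ∸ 2 ⁾-generator ⟩)

  -- Elements are compared as vectors, ignoring the membership proofs.
  sPF : Setoid (c ⊔ ℓ₁) 0ℓ
  sPF = record
    { Carrier       = Σ[ p ∈ Vec ℕ n ] IsSphericalPF p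
    ; _≈_           = λ P Q → proj₁ P ≡ proj₁ Q
    ; isEquivalence = record { refl = refl ; sym = sym ; trans = trans }
    }

  sumPF : Setoid.Carrier sPF → ℕ
  sumPF (p , _) = Vec.sum p

record SimpleGraph (n : ℕ) : Set where
  field
    adj        : Fin n → Fin n → Bool
    adj-sym    : ∀ u v → adj u v ≡ adj v u
    adj-irrefl : ∀ u → adj u u ≡ false

open SimpleGraph public

module _ {n : ℕ} (G : SimpleGraph n) where

  data Walk : Fin n → Fin n → Set where
    []  : ∀ {u} → Walk u u
    _∷_ : ∀ {u v w} → adj G u v ≡ true → Walk v w → Walk u w

  vertices : ∀ {u v} → Walk u v → List (Fin n)
  vertices {u} []      = u ∷ []
  vertices {u} (_ ∷ w) = u ∷ vertices w

  Path : Fin n → Fin n → Set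
  Path u v = Σ[ w ∈ Walk u v ] Unique (vertices w)

  -- The vertex following u, or u itself if the walk is trivial.
  next : ∀ {u v} → Walk u v → Fin n
  next {u} []                = u
  next     (_∷_ {v = v} _ _) = v

-- A tree is a graph in which any two vertices are joined by exactly one path.
record RootedTree (n : ℕ) : Set where
  field
    graph       : SimpleGraph n
    path        : ∀ u v → Path graph u v
    path-unique : ∀ {u v} (p q : Path graph u v) →
                  vertices graph (proj₁ p) ≡ vertices graph (proj₁ q)
    root        : Fin n

  -- Only meaningful for i ≢ root; it returns root at the root.
  par : Fin n → Fin n
  par i = next graph (proj₁ (path i root))

  IsChildOf : Fin n → Fin n → Set
  IsChildOf i v = i ≢ root × par i ≡ v

  IsAncestorOf : Fin n → Fin n → Set
  IsAncestorOf i j = i ≢ j × i ∈ vertices graph (proj₁ (path root j))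

  isAncestorOf? : Decidable IsAncestorOf
  isAncestorOf? i j =
    ¬? (i ≟ j) ×-dec DecMembership._∈?_ _≟_ i (vertices graph (proj₁ (path root j)))

  IsUprooted : Set
  IsUprooted = ∀ i → IsChildOf i root → i < root

open RootedTree public

-- Two rooted trees on [n] are the same when they have the same root and edges.
record _≈ₜ_ {n : ℕ} (S T : RootedTree n) : Set where
  field
    root-≡ : root S ≡ root T
    adj-≡  : ∀ u v → adj (graph S) u v ≡ adj (graph T) u v

𝓤 : ℕ → Setoid 0ℓ 0ℓ
𝓤 n = record
  { Carrier       = Σ[ T ∈ RootedTree n ] IsUprooted T
  ; _≈_           = λ S T → proj₁ S ≈ₜ proj₁ T
  ; isEquivalence = record
    { refl  = record { root-≡ = refl ; adj-≡ = λ _ _ → refl }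
    ; sym   = λ e → record { root-≡ = sym (root-≡ e) ; adj-≡ = λ u v → sym (adj-≡ e u v) }
    ; trans = λ e f → record { root-≡ = trans (root-≡ e) (root-≡ f)
                             ; adj-≡  = λ u v → trans (adj-≡ e u v) (adj-≡ f u v) }
    }
  }
  where open _≈ₜ_

module _ {n : ℕ} (T : RootedTree n) where

  IsInversion : Fin n → Fin n → Set
  IsInversion i j = i ≢ root T × j ≢ root T × IsAncestorOf T i j × j < i

  isInversion? : Decidable IsInversion
  isInversion? i j =
    ¬? (i ≟ root T) ×-dec ¬? (j ≟ root T) ×-dec isAncestorOf? T i j ×-dec j <? i

-- Intended for T a spanning tree of H; every tree on [n] spans complete n.
κ : ∀ {n} → Multigraph n → RootedTree n → ℕ
κ H T = ∑ λ i → ∑ λ j → if does (isInversion? T i j) then mult H (par T i) j else 0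

{-# OPTIONS --safe #-}
module Submission where

-- A vector p is a spherical parking function of K_{n+1} iff p ≥ 1 and no nonempty proper A ⊆ [n]
-- has p_i ≥ n + 1 − |A| for all i ∈ A.  Let r be the largest index with p_r = 1, set r on fire and
-- let fire spread depth first: a burning vertex v asks every unburnt j, from the largest label to
-- the smallest; j resists p_j − 1 times, then catches fire as a child of v and burns completely
-- before v goes on.  By sphericality everything burns, and the fire traces a tree rooted at r.
-- The same traversal can be steered by a tree ("j catches fire iff v is its parent"); either set
-- of answers determines the other, which gives the bijection.  The first child of r is the largest
-- j ≠ r with p_j = 1, so "r is the largest" translates into "uprooted".  When j catches fire, of
-- the b burnt vertices p_j − 1 have been resisted, one is the parent, and the others are exactly
-- the parents of the i > j above j, so p_j + #{inversions (i , j)} = b; sum over all j ≠ r.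

open import Defs
open import Algebra.Apartness.Bundles using (HeytingField)
open import Algebra.Properties.Ring using (-0#≈0#)
open import Data.Bool.Base using (Bool; true; false; if_then_else_; not; _∨_)
open import Data.Bool.Properties using (∨-comm; ⇔→≡)
open import Data.Fin.Base as Fin using (Fin; zero; suc; toℕ; fromℕ; inject₁)
open import Data.Fin.Properties using (_≟_; _<?_; <⇒≢; toℕ-fromℕ; toℕ-inject₁; toℕ-injective; toℕ<n)
open import Data.Fin.Subset using (Subset; inside; outside; ∁; Nonempty; ∣_∣; ⊤)
open import Data.Fin.Subset.Properties using (∣p∣≤n; ∣p∣≡n⇒p≡⊤; ∈⊤; ∣⊤∣≡n)
open import Data.Integer.Base as ℤ using (+_)
open import Data.List.Base as List using (List; []; _∷_; _∷ʳ_; length; foldr)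
open import Data.List.Membership.Propositional using (_∈_; _∉_)
open import Data.List.Properties using (∷-injective; unfold-reverse; reverse-injective)
open import Data.List.Relation.Binary.Permutation.Propositional using (↭-sym; ↭⇒↭ₛ)
open import Data.List.Relation.Binary.Permutation.Propositional.Properties using (↭-reverse)
open import Data.List.Relation.Unary.All as All using (All; []; _∷_)
open import Data.List.Relation.Unary.All.Properties using (++⁺; ¬Any⇒All¬)
open import Data.List.Relation.Unary.AllPairs using ([]; _∷_)
open import Data.List.Relation.Unary.Any using (here; there)
open import Data.List.Relation.Unary.Any.Properties using (reverse⁺; reverse⁻)
open import Data.List.Relation.Unary.Unique.Propositional using (Unique)
open import Data.List.Relation.Unary.Unique.Propositional.Properties using (Unique[x∷xs]⇒x∉xs)
open import Data.Nat.Base as ℕ using (ℕ; zero; suc; _+_; _∸_; _≤_; _<_; s≤s; z≤n)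
open import Data.Nat.Combinatorics using (_C_; nC1≡n; nCk+nC[k+1]≡[n+1]C[k+1])
open import Data.Product.Base using (Σ-syntax; ∃-syntax; _×_; _,_; proj₁; proj₂)
open import Data.Sum.Base using (_⊎_; inj₁; inj₂)
open import Data.Vec.Base as Vec using (Vec; lookup; zipWith; _[_]≔_; here; there)
open import Data.Vec.Properties using (≡-dec; lookup-zipWith; lookup-map; lookup-replicate; lookup⇒[]=; []=⇒lookup;
  lookup∘update; lookup∘update′; lookup∘tabulate; tabulate∘lookup; tabulate-cong)
open import Function.Base using (_∘_)
open import Function.Bundles using (Bijection; mk⇔)
open import Relation.Binary.PropositionalEquality using (_≡_; _≢_; refl; sym; trans; cong; cong₂; subst;
  setoid; module ≡-Reasoning)
open import Relation.Nullary.Decidable using (Dec; yes; no; does; ¬?; _×-dec_; dec-true; dec-false)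
open import Relation.Nullary.Negation.Core using (¬_; contradiction)
open import Relation.Unary using (Decidable)

import Algebra.Properties.CommutativeMonoid.Sum
import Data.Integer.Properties as ℤ
import Data.List.Membership.DecPropositional as DecMembership
import Data.List.Relation.Binary.Permutation.Setoid.Properties as Permutation
import Data.Nat.Properties as ℕ

private module ∑ℕ = Algebra.Properties.CommutativeMonoid.Sum ℕ.+-0-commutativeMonoid

-- Membership in the monomial ideals

infix 4 _≼_
_≼_ : ∀ {n} → Vec ℕ n → Vec ℕ n → Set
e ≼ p = ∀ i → lookup e i ≤ lookup p i

∸-+-≼ : ∀ {n} {e p : Vec ℕ n} → e ≼ p → zipWith _+_ (zipWith _∸_ p e) e ≡ p
∸-+-≼ {e = Vec.[]}    {Vec.[]}    _   = refl
∸-+-≼ {e = _ Vec.∷ _} {_ Vec.∷ _} e≼p =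
  cong₂ Vec._∷_ (ℕ.m∸n+n≡m (e≼p zero)) (∸-+-≼ (e≼p ∘ suc))

module _ {c ℓ₁ ℓ₂} (K : HeytingField c ℓ₁ ℓ₂) {n : ℕ} where

  private module K = HeytingField K
  open PolynomialRing K n

  -- `1 - 0` is invertible, so in a Heyting field 1 is apart from 0, and apartness is irreflexive.
  1≉0 : ¬ (K.1# K.≈ K.0#)
  1≉0 1≈0 = K.#-irrefl 1≈0 (K.invertible⇒# (K.1# , K.trans (K.*-identityˡ _) 1-0≈1
                                                   , K.trans (K.*-identityʳ _) 1-0≈1))
    where
    1-0≈1 : K.1# K.+ K.- K.0# K.≈ K.1#
    1-0≈1 = K.trans (K.+-congˡ (-0#≈0# (record { isRing = K.isRing }))) (K.+-identityʳ _)

  module _ {ι} {I : Set ι} (e : I → Exponent) (p : Exponent) where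

    ≼⇒monomial∈ : ∀ i → e i ≼ p → monomial p ∈⟨ monomial ∘ e ⟩
    ≼⇒monomial∈ i e≼p = (monomial (zipWith _∸_ p (e i)) , i) ∷ [] , eq
      where
      eq : monomial p ≈ₚ monomial (zipWith _∸_ p (e i)) *ₚ monomial (e i) +ₚ 0ₚ
      eq x rewrite ∸-+-≼ {e = e i} {p} e≼p with ≡-dec ℕ._≟_ p x
      ... | yes _ = K.+-congʳ (K.sym (K.*-identityˡ _))
      ... | no  _ = K.refl

    -- Compare the coefficients of x^p: it is 1 on the left, while every term of a combination of
    -- generators has an exponent above some `e i`, hence different from `p`.
    monomial∉ : (∀ i → ¬ e i ≼ p) → ¬ monomial p ∈⟨ monomial ∘ e ⟩
    monomial∉ e⋠p (ts , p≈) = 1≉0 (K.trans (K.sym (K.+-identityʳ _)) (K.trans (K.sym lhs) (K.trans (p≈ p) rhs)))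
      where
      Avoids : Polynomial → Set c
      Avoids = All (λ (_ , d) → d ≢ p)

      avoids-* : ∀ q i → Avoids (q *ₚ monomial (e i))
      avoids-* []            i = []
      avoids-* ((_ , d) ∷ q) i = d+e≢p ∷ avoids-* q i
        where
        d+e≢p : zipWith _+_ d (e i) ≢ p
        d+e≢p refl = e⋠p i λ j → ℕ.≤-trans (ℕ.m≤n+m _ (lookup d j))
          (ℕ.≤-reflexive (sym (lookup-zipWith _+_ j d (e i))))

      avoids-∑ : ∀ ts → Avoids (foldr (λ (q , i) s → q *ₚ monomial (e i) +ₚ s) 0ₚ ts)
      avoids-∑ []             = []
      avoids-∑ ((q , i) ∷ ts) = ++⁺ (avoids-* q i) (avoids-∑ ts)

      coefficient≈0 : ∀ {q} → Avoids q → coefficient q p K.≈ K.0#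
      coefficient≈0 []                            = K.refl
      coefficient≈0 (_∷_ {x = _ , d} d≢p avoids) with ≡-dec ℕ._≟_ d p
      ... | yes d≡p = contradiction d≡p d≢p
      ... | no  _   = coefficient≈0 avoids

      lhs : coefficient (monomial p) p K.≈ K.1# K.+ K.0#
      lhs with ≡-dec ℕ._≟_ p p
      ... | yes _   = K.refl
      ... | no  p≢p = contradiction refl p≢p

      rhs = coefficient≈0 (avoids-∑ ts)

-- Spherical parking functions of the complete graph as a numerical condition

∑-outside : ∀ {n} (A : Subset n) → ∑ (λ j → if lookup A j then 0 else 1) + ∣ A ∣ ≡ n
∑-outside Vec.[]              = refl
∑-outside (inside  Vec.∷ A) = trans (ℕ.+-suc _ ∣ A ∣) (cong suc (∑-outside A))
∑-outside (outside Vec.∷ A) = cong suc (∑-outside A)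

-- A vertex of A is joined once to the root, whence `cong suc`, and once to each of the n - |A|
-- other vertices outside A.
d-complete : ∀ {n} (A : Subset n) i → lookup A i ≡ true → d (complete (suc n)) A i + ∣ A ∣ ≡ suc n
d-complete {n} A i i∈A = cong suc (trans (cong (_+ ∣ A ∣) (∑ℕ.sum-cong-≗ pointwise)) (∑-outside A))
  where
  pointwise : ∀ j → (if lookup (∁ A) j then mult (complete (suc n)) (suc i) (suc j) else 0)
                    ≡ (if lookup A j then 0 else 1)
  pointwise j rewrite lookup-map j not A with i ≟ j
  ... | yes refl rewrite i∈A = refl
  ... | no  _ with lookup A j
  ...   | true  = refl
  ...   | false = refl

-- Divisibility of x^p by m_A for the complete graph, where the exponents on A all equal n + 1 -
-- |A|; written with a sum to avoid truncated subtraction.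
Exceeds : ∀ {n} → Vec ℕ n → Subset n → Set
Exceeds {n} p A = ∀ i → lookup A i ≡ true → suc n ≤ lookup p i + ∣ A ∣

-- For the full set, m_A is the product of all variables, so the first half is divisibility by it;
-- the second half excludes m_A for every proper A.
IsSpherical : ∀ {n} → Vec ℕ n → Set
IsSpherical {n} p = (∀ i → 1 ≤ lookup p i) × (∀ A → Nonempty A → ∣ A ∣ < n → ¬ Exceeds p A)

module _ {n} {p : Vec ℕ n} {A : Subset n} where

  ≼⇒Exceeds : m-exponent (complete (suc n)) A ≼ p → Exceeds p A
  ≼⇒Exceeds m≼p i i∈A = ℕ.≤-trans (ℕ.≤-reflexive (sym (d-complete A i i∈A))) (ℕ.+-monoˡ-≤ ∣ A ∣ d≤p)
    where
    d≤p : d (complete (suc n)) A i ≤ lookup p i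
    d≤p with m≤p ← m≼p i
      rewrite lookup∘tabulate (λ i → if lookup A i then d (complete (suc n)) A i else 0) i | i∈A = m≤p

  Exceeds⇒≼ : Exceeds p A → m-exponent (complete (suc n)) A ≼ p
  Exceeds⇒≼ exc i rewrite lookup∘tabulate (λ i → if lookup A i then d (complete (suc n)) A i else 0) i
    with lookup A i in i∈A
  ... | false = z≤n
  ... | true  = ℕ.+-cancelʳ-≤ ∣ A ∣ _ _ (ℕ.≤-trans (ℕ.≤-reflexive (d-complete A i i∈A)) (exc i i∈A))

module _ {c ℓ₁ ℓ₂} (K : HeytingField c ℓ₁ ℓ₂) {m : ℕ} (p : Vec ℕ (suc (suc m))) where

  private
    n : ℕ
    n = suc (suc m)

  IsSphericalPF⇒IsSpherical : IsSphericalPF K (complete (suc n)) p → IsSpherical p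
  IsSphericalPF⇒IsSpherical (p∈𝓜 , p∉𝓜′) = positive , not-exceeding
    where
    not-exceeding : ∀ A → Nonempty A → ∣ A ∣ < n → ¬ Exceeds p A
    not-exceeding A ne (s≤s A≤) exc = p∉𝓜′ (≼⇒monomial∈ K _ p (A , ne , A≤) (Exceeds⇒≼ {p = p} {A} exc))

    positive : ∀ i → 1 ≤ lookup p i
    positive i with 1 ℕ.≤? lookup p i
    ... | yes 1≤p = 1≤p
    -- If p_i = 0, no generator at all divides x^p: proper sets are excluded already, and the full
    -- set would force p_i ≥ 1.
    ... | no  1≰p = contradiction p∈𝓜 (monomial∉ K _ p λ (A , ne) m≼p → divides A ne (≼⇒Exceeds {p = p} {A} m≼p))
      where
      divides : ∀ A → Nonempty A → ¬ Exceeds p A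
      divides A ne exc with ℕ.m≤n⇒m<n∨m≡n (∣p∣≤n A)
      ... | inj₁ A<n = not-exceeding A ne A<n exc
      ... | inj₂ A≡n = 1≰p (ℕ.+-cancelʳ-≤ n 1 _ (subst (λ k → suc n ≤ lookup p i + k) A≡n
              (exc i (trans (cong (λ B → lookup B i) (∣p∣≡n⇒p≡⊤ {p = A} A≡n)) (lookup-replicate i inside)))))

  IsSpherical⇒IsSphericalPF : IsSpherical p → IsSphericalPF K (complete (suc n)) p
  IsSpherical⇒IsSphericalPF (positive , not-exceeding) =
      ≼⇒monomial∈ K _ p (⊤ , zero , ∈⊤) (Exceeds⇒≼ {p = p} {⊤} λ i _ →
        subst (λ k → suc n ≤ lookup p i + k) (sym (∣⊤∣≡n n)) (ℕ.+-monoˡ-≤ n (positive i)))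
    , monomial∉ K _ p λ (A , ne , A≤) m≼p → not-exceeding A ne (s≤s A≤) (≼⇒Exceeds {p = p} {A} m≼p)

-- Trees

infix 4 _∈?_
_∈?_ : ∀ {n} (i : Fin n) (is : List (Fin n)) → Dec (i ∈ is)
_∈?_ = DecMembership._∈?_ _≟_

Unique-reverse : ∀ {a} {A : Set a} {xs : List A} → Unique xs → Unique (List.reverse xs)
Unique-reverse {xs = xs} = Permutation.Unique-resp-↭ (setoid _) (↭⇒↭ₛ (↭-sym (↭-reverse xs)))

if-does-yes : ∀ {p} {P : Set p} (P? : Dec P) {x : ℕ} → P → (if does P? then x else 0) ≡ x
if-does-yes P? {x} p = cong (if_then x else 0) (dec-true P? p)

if-does-no : ∀ {p} {P : Set p} (P? : Dec P) {x : ℕ} → ¬ P → (if does P? then x else 0) ≡ 0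
if-does-no P? {x} ¬p = cong (if_then x else 0) (dec-false P? ¬p)

if-does-cong : ∀ {p q} {P : Set p} {Q : Set q} (P? : Dec P) (Q? : Dec Q) {x y : ℕ} →
               (P → Q) → (Q → P) → (P → x ≡ y) →
               (if does P? then x else 0) ≡ (if does Q? then y else 0)
if-does-cong (yes p) (yes _)  _   _   x≡y = x≡y p
if-does-cong (yes p) (no ¬q)  P⇒Q _   _   = contradiction (P⇒Q p) ¬q
if-does-cong (no ¬p) (yes q)  _   Q⇒P _   = contradiction (Q⇒P q) ¬p
if-does-cong (no _)  (no _)   _   _   _   = refl

-- Walks and paths

module _ {n} {G : SimpleGraph n} where

  source∈ : ∀ {u v} (w : Walk G u v) → u ∈ vertices G w
  source∈ []      = here refl
  source∈ (_ ∷ _) = here refl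

  target∈ : ∀ {u v} (w : Walk G u v) → v ∈ vertices G w
  target∈ []      = here refl
  target∈ (_ ∷ w) = there (target∈ w)

  infixl 5 _++ʷ_
  _++ʷ_ : ∀ {u v x} → Walk G u v → Walk G v x → Walk G u x
  []      ++ʷ w′ = w′
  (e ∷ w) ++ʷ w′ = e ∷ (w ++ʷ w′)

  snoc : ∀ {u v x} → Walk G u v → adj G v x ≡ true → Walk G u x
  snoc w e = w ++ʷ (e ∷ [])

  vertices-snoc : ∀ {u v x} (w : Walk G u v) (e : adj G v x ≡ true) →
                  vertices G (snoc w e) ≡ vertices G w ∷ʳ x
  vertices-snoc []      e = refl
  vertices-snoc (_ ∷ w) e = cong (_ ∷_) (vertices-snoc w e)

  reverseʷ : ∀ {u v} → Walk G u v → Walk G v u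
  reverseʷ []      = []
  reverseʷ (e ∷ w) = snoc (reverseʷ w) (trans (adj-sym G _ _) e)

  vertices-reverse : ∀ {u v} (w : Walk G u v) → vertices G (reverseʷ w) ≡ List.reverse (vertices G w)
  vertices-reverse []      = refl
  vertices-reverse {u} (e ∷ w) =
    trans (vertices-snoc (reverseʷ w) _)
      (trans (cong (_∷ʳ u) (vertices-reverse w)) (sym (unfold-reverse u (vertices G w))))

  reverseᵖ : ∀ {u v} → Path G u v → Path G v u
  reverseᵖ (w , unique) = reverseʷ w , subst Unique (sym (vertices-reverse w)) (Unique-reverse unique)

  pathFrom : ∀ {u v x} (w : Walk G u v) → Unique (vertices G w) → x ∈ vertices G w →
             Σ[ p ∈ Path G x v ] (∀ {y} → y ∈ vertices G (proj₁ p) → y ∈ vertices G w)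
  pathFrom []      unique       (here refl) = ([] , unique) , λ y∈ → y∈
  pathFrom (e ∷ w) unique       (here refl) = (e ∷ w , unique) , λ y∈ → y∈
  pathFrom (_ ∷ w) (_ ∷ unique) (there x∈)  with p , p⊆ ← pathFrom w unique x∈ = p , there ∘ p⊆

  -- Loop erasure: when the source already occurs on the path made from the rest, that path is cut
  -- at the occurrence.
  toPath : ∀ {u v} → Walk G u v → Path G u v
  toPath     []      = [] , [] ∷ []
  toPath {u} (e ∷ w) with toPath w
  ... | w′ , unique with u ∈? vertices G w′
  ...   | yes u∈ = proj₁ (pathFrom w′ unique u∈)
  ...   | no  u∉ = e ∷ w′ , ¬Any⇒All¬ _ u∉ ∷ unique

  closed-path-trivial : ∀ {u} (p : Path G u u) → vertices G (proj₁ p) ≡ u ∷ []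
  closed-path-trivial ([]    , _)      = refl
  closed-path-trivial (_ ∷ w , unique) = contradiction (target∈ w) (Unique[x∷xs]⇒x∉xs unique)

  private
    second : Fin n → List (Fin n) → Fin n
    second _ (_ ∷ v ∷ _) = v
    second u _           = u

    next≡second : ∀ {u v} (w : Walk G u v) → next G w ≡ second u (vertices G w)
    next≡second []          = refl
    next≡second (_ ∷ [])    = refl
    next≡second (_ ∷ _ ∷ _) = refl

  -- `path-unique` compares vertex lists only, so `next` is recovered from the list; this makes
  -- `par` independent of the chosen path.
  next-cong : ∀ {u v x} {w : Walk G u v} {w′ : Walk G u x} → vertices G w ≡ vertices G w′ → next G w ≡ next G w′
  next-cong {u} {w = w} {w′} eq = trans (next≡second w) (trans (cong (second u) eq) (sym (next≡second w′)))

data Rooted {n} (f : Fin n → Fin n) (r : Fin n) : Fin n → Set where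
  here  : Rooted f r r
  climb : ∀ {j} → Rooted f r (f j) → Rooted f r j

module _ {n} (T : RootedTree n) where

  private G = graph T

  next≡par : ∀ {u} (p : Path G u (root T)) → next G (proj₁ p) ≡ par T u
  next≡par {u} p = next-cong {w = proj₁ p} {proj₁ (path T u (root T))} (path-unique T p (path T u (root T)))

  par-adj : ∀ {u} → u ≢ root T → adj G u (par T u) ≡ true
  par-adj {u} u≢r with path T u (root T)
  ... | []    , _ = contradiction refl u≢r
  ... | e ∷ _ , _ = e

  -- If u lies on the path from v to the root, the edge from v to u followed by the rest of that
  -- path from u is simple, so by uniqueness u is the parent of v. Otherwise u can be put in front
  -- of that path, and v is the parent of u.
  adj⇒par : ∀ {u v} → adj G u v ≡ true → (u ≢ root T × par T u ≡ v) ⊎ (v ≢ root T × par T v ≡ u)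
  adj⇒par {u} {v} e with u ∈? vertices G (proj₁ (path T v (root T)))
  ... | yes u∈ = inj₂ (through (proj₁ (path T v (root T))) (proj₂ (path T v (root T))) u∈)
    where
    through : (w : Walk G v (root T)) → Unique (vertices G w) → u ∈ vertices G w → v ≢ root T × par T v ≡ u
    through []       _             (here refl) = contradiction (trans (sym e) (adj-irrefl G u)) λ ()
    through (_ ∷ _)  _             (here refl) = contradiction (trans (sym e) (adj-irrefl G u)) λ ()
    through (_ ∷ w′) (v∉ ∷ unique) (there u∈)  =
      let (w″ , unique″) , w″⊆w′ = pathFrom w′ unique u∈
          v∉w″ = Unique[x∷xs]⇒x∉xs (v∉ ∷ unique) ∘ w″⊆w′
      in (λ { refl → v∉w″ (target∈ w″) })
       , sym (next≡par (trans (adj-sym G v u) e ∷ w″ , ¬Any⇒All¬ _ v∉w″ ∷ unique″))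
  ... | no  u∉ = inj₁ ((λ { refl → u∉ (target∈ (proj₁ (path T v (root T)))) })
                     , sym (next≡par (e ∷ proj₁ (path T v (root T)) , ¬Any⇒All¬ _ u∉ ∷ proj₂ (path T v (root T)))))

  rooted : ∀ j → Rooted (par T) (root T) j
  rooted j = go (proj₁ (path T j (root T))) (proj₂ (path T j (root T)))
    where
    go : ∀ {j} (w : Walk G j (root T)) → Unique (vertices G w) → Rooted (par T) (root T) j
    go []      _             = here
    go (e ∷ w) (j∉ ∷ unique) = climb (subst (Rooted _ _) (next≡par (e ∷ w , j∉ ∷ unique)) (go w unique))

-- Trees built from ancestor lists

isHead : ∀ {n} → List (Fin n) → Fin n → Bool
isHead []      _ = false
isHead (x ∷ _) v = does (x ≟ v)

isHead⇒ : ∀ {n} xs {v : Fin n} → isHead xs v ≡ true → ∃[ σ ] xs ≡ v ∷ σ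
isHead⇒ (x ∷ σ) {v} h with x ≟ v
... | yes refl = σ , refl

⇒isHead : ∀ {n xs σ} {v : Fin n} → xs ≡ v ∷ σ → isHead xs v ≡ true
⇒isHead {v = v} refl with v ≟ v
... | yes _   = refl
... | no  v≢v = contradiction refl v≢v

-- The number of inversions (i , j) of a tree with root r in which j has the proper ancestors σ.
inversions : ∀ {n} → Fin n → Fin n → List (Fin n) → ℕ
inversions r j σ = ∑ λ i → if does (i ∈? σ ×-dec ¬? (i ≟ r) ×-dec j <? i) then 1 else 0

-- A rooted tree given by the list of proper ancestors of each vertex, nearest first.
record AncestorMap (n : ℕ) : Set where
  field
    top   : Fin n
    anc   : Fin n → List (Fin n)
    anc-r : anc top ≡ []
    anc-[] : ∀ {j} → anc j ≡ [] → j ≡ top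
    anc-∷ : ∀ {j v σ} → anc j ≡ v ∷ σ → anc v ≡ σ

  parent : Fin n → Fin n
  parent j with anc j
  ... | []    = j
  ... | v ∷ _ = v

  parent-∷ : ∀ {j v σ} → anc j ≡ v ∷ σ → parent j ≡ v
  parent-∷ {j} eq with anc j
  parent-∷ refl | _ ∷ _ = refl

  parent-[] : ∀ {j} → anc j ≡ [] → parent j ≡ j
  parent-[] {j} eq with anc j
  ... | [] = refl

  depth : Fin n → ℕ
  depth j = length (anc j)

  depth-∷ : ∀ {j v σ} → anc j ≡ v ∷ σ → depth j ≡ suc (depth v)
  depth-∷ eq = trans (cong length eq) (cong (suc ∘ length) (sym (anc-∷ eq)))

  ≢top⇒∷ : ∀ {j} → j ≢ top → ∃[ v ] ∃[ σ ] anc j ≡ v ∷ σ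
  ≢top⇒∷ {j} j≢r with anc j in eq
  ... | []    = contradiction (anc-[] eq) j≢r
  ... | v ∷ σ = v , σ , refl

  deeper⇒≢top : ∀ {u v} → u ≢ v → depth v ≤ depth u → u ≢ top
  deeper⇒≢top {v = v} u≢v v≤u refl with anc v in eq
  ... | []    = u≢v (sym (anc-[] eq))
  ... | _ ∷ _ = contradiction (ℕ.≤-trans v≤u (ℕ.≤-reflexive (cong length anc-r))) λ ()

  ancestors-higher : ∀ {j σ} → anc j ≡ σ → All (λ i → depth i ℕ.< length σ) σ
  ancestors-higher {σ = []}    _  = []
  ancestors-higher {σ = v ∷ σ} eq =
      s≤s (ℕ.≤-reflexive (cong length (anc-∷ eq)))
    ∷ All.map ℕ.m≤n⇒m≤1+n (ancestors-higher (anc-∷ eq))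

  ∈anc⇒depth< : ∀ {i j} → i ∈ anc j → depth i ℕ.< depth j
  ∈anc⇒depth< = All.lookup (ancestors-higher refl)

  -- A vertex recurring among its own ancestors would be less deep than itself.
  anc-unique : ∀ {j σ} → anc j ≡ σ → Unique (j ∷ σ)
  anc-unique {j} {[]}    eq = [] ∷ []
  anc-unique {j} {v ∷ σ} eq =
      ¬Any⇒All¬ _ (λ j∈ → ℕ.<-irrefl refl (∈anc⇒depth< (subst (j ∈_) (sym eq) j∈)))
    ∷ anc-unique (anc-∷ eq)

  treeGraph : SimpleGraph n
  treeGraph = record
    { adj        = λ u v → isHead (anc u) v ∨ isHead (anc v) u
    ; adj-sym    = λ u v → ∨-comm (isHead (anc u) v) _
    ; adj-irrefl = irrefl
    }
    where
    irrefl : ∀ u → isHead (anc u) u ∨ isHead (anc u) u ≡ false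
    irrefl u with isHead (anc u) u in eq
    ... | false = refl
    ... | true with σ , anc-u ← isHead⇒ (anc u) eq = contradiction (depth-∷ anc-u) (ℕ.<⇒≢ ℕ.≤-refl)

  edge⇒ : ∀ {u v} → adj treeGraph u v ≡ true → (∃[ σ ] anc u ≡ v ∷ σ) ⊎ (∃[ σ ] anc v ≡ u ∷ σ)
  edge⇒ {u} {v} e with isHead (anc u) v in eq
  ... | true  = inj₁ (isHead⇒ (anc u) eq)
  ... | false = inj₂ (isHead⇒ (anc v) e)

  ⇒edge : ∀ {u v σ} → anc u ≡ v ∷ σ → adj treeGraph u v ≡ true
  ⇒edge eq rewrite ⇒isHead eq = refl

  climbWalk : ∀ {j σ} → anc j ≡ σ → Σ[ w ∈ Walk treeGraph j top ] vertices treeGraph w ≡ j ∷ σ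
  climbWalk {j} {[]}    eq with refl ← anc-[] eq = [] , refl
  climbWalk {j} {v ∷ σ} eq with w , w-vertices ← climbWalk (anc-∷ eq) = ⇒edge eq ∷ w , cong (j ∷_) w-vertices

  climbPath : ∀ j → Path treeGraph j top
  climbPath j with w , w-vertices ← climbWalk {j} refl = w , subst Unique (sym w-vertices) (anc-unique refl)

  treePath : ∀ u v → Path treeGraph u v
  treePath u v = toPath (proj₁ (climbPath u) ++ʷ reverseʷ (proj₁ (climbPath v)))

  -- A simple path that has gone down once can never go up again.
  monotone-after-descent : ∀ {x c v σ} (w : Walk treeGraph c v) → Unique (x ∷ vertices treeGraph w) →
               anc c ≡ x ∷ σ → depth c ≤ depth v
  monotone-after-descent []      _                       _  = ℕ.≤-refl
  monotone-after-descent (e ∷ w) unique@(_ ∷ unique′) eq with edge⇒ e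
  ... | inj₂ (_ , eq′) =
    ℕ.≤-trans (ℕ.≤-trans (ℕ.n≤1+n _) (ℕ.≤-reflexive (sym (depth-∷ eq′)))) (monotone-after-descent w unique′ eq′)
  ... | inj₁ (_ , eq′) with refl ← trans (sym eq) eq′ =
    contradiction (there (source∈ w)) (Unique[x∷xs]⇒x∉xs unique)

  -- A first step down would leave the end of the path deeper than u, so a path to a vertex no
  -- deeper than u starts with the parent of u.
  path-starts-up : ∀ {u v x y σ} (e : adj treeGraph u x ≡ true) (w : Walk treeGraph x y) →
                   Unique (u ∷ vertices treeGraph w) → depth y ≤ depth u → anc u ≡ v ∷ σ → x ≡ v
  path-starts-up e w unique y≤u eq with edge⇒ e
  ... | inj₁ (_ , eq′) = proj₁ (∷-injective (trans (sym eq′) eq))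
  ... | inj₂ (_ , eq′) = contradiction
    (ℕ.≤-trans (ℕ.≤-reflexive (sym (depth-∷ eq′))) (ℕ.≤-trans (monotone-after-descent w unique eq′) y≤u))
    (ℕ.<-irrefl refl)

  private
    Unambiguous : Fin n → Fin n → Set
    Unambiguous u v = (p q : Path treeGraph u v) → vertices treeGraph (proj₁ p) ≡ vertices treeGraph (proj₁ q)

    unambiguous-sym : ∀ {u v} → Unambiguous u v → Unambiguous v u
    unambiguous-sym unamb p q = reverse-injective (trans (sym (vertices-reverse (proj₁ p)))
      (trans (unamb (reverseᵖ p) (reverseᵖ q)) (vertices-reverse (proj₁ q))))

    -- Induction on the sum of the depths. Reversal lets the source be the deeper end; both paths
    -- then start with its parent, and removing that step lowers the sum.
    unambiguous : ∀ N u v → depth u + depth v ≤ N → Unambiguous u v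
    unambiguous′ : ∀ N u v → u ≢ v → depth v ≤ depth u → depth u + depth v ≤ N → Unambiguous u v

    unambiguous N u v ≤N with u ≟ v
    ... | yes refl = λ p q → trans (closed-path-trivial p) (sym (closed-path-trivial q))
    ... | no  u≢v with ℕ.≤-total (depth v) (depth u)
    ...   | inj₁ v≤u = unambiguous′ N u v u≢v v≤u ≤N
    ...   | inj₂ u≤v = unambiguous-sym (unambiguous′ N v u (u≢v ∘ sym) u≤v (subst (_≤ N) (ℕ.+-comm (depth u) _) ≤N))

    unambiguous′ N u v u≢v v≤u ≤N ([]    , _)      _           = contradiction refl u≢v
    unambiguous′ N u v u≢v v≤u ≤N (_ ∷ _ , _)      ([]    , _) = contradiction refl u≢v
    unambiguous′ N u v u≢v v≤u ≤N (e ∷ w , unique) (e′ ∷ w′ , unique′)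
      with x , σ , eq ← ≢top⇒∷ (deeper⇒≢top u≢v v≤u)
      with refl ← path-starts-up e w unique v≤u eq
      with refl ← path-starts-up e′ w′ unique′ v≤u eq
      with N | subst (λ k → k + depth v ≤ N) (depth-∷ eq) ≤N
    ... | suc N′ | s≤s ≤N′ with _ ∷ unique₁ ← unique | _ ∷ unique₁′ ← unique′ =
      cong (u ∷_) (unambiguous N′ x v ≤N′ (w , unique₁) (w′ , unique₁′))

  tree : RootedTree n
  tree = record
    { graph       = treeGraph
    ; path        = treePath
    ; path-unique = λ {u} {v} → unambiguous (depth u + depth v) u v ℕ.≤-refl
    ; root        = top
    }

  par-tree : ∀ {j v σ} → anc j ≡ v ∷ σ → par tree j ≡ v
  par-tree {j} eq with treePath j top
  ... | []    , _      = contradiction (trans (sym anc-r) eq) λ ()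
  ... | e ∷ w , unique =
    path-starts-up e w unique (subst (_≤ depth j) (sym (cong length anc-r)) z≤n) eq

  vertices-from-top : ∀ j → vertices treeGraph (proj₁ (treePath top j)) ≡ List.reverse (j ∷ anc j)
  vertices-from-top j = trans (path-unique tree (treePath top j) (reverseᵖ (climbPath j)))
    (trans (vertices-reverse (proj₁ (climbPath j))) (cong List.reverse (proj₂ (climbWalk {j} refl))))

  -- If i is a proper ancestor of j and not the root, its parent is less deep than j, hence
  -- different from j, and the inversion contributes exactly one edge. The sums are exchanged to
  -- group inversions by the descendant `j`.
  κ-tree : κ (complete n) tree ≡ ∑ λ j → inversions top j (anc j)
  κ-tree = trans (∑ℕ.∑-comm (λ i j → if does (isInversion? tree i j) then mult (complete n) (par tree i) j else 0))
                 (∑ℕ.sum-cong-≗ λ j → ∑ℕ.sum-cong-≗ λ i → pointwise i j)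
    where
    pointwise : ∀ i j → (if does (isInversion? tree i j) then mult (complete n) (par tree i) j else 0)
                        ≡ (if does (i ∈? anc j ×-dec ¬? (i ≟ top) ×-dec j <? i) then 1 else 0)
    pointwise i j =
      if-does-cong (isInversion? tree i j) (i ∈? anc j ×-dec ¬? (i ≟ top) ×-dec j <? i) ⇒ ⇐ (mult≡1 ∘ ⇒)
      where
      ⇒ : IsInversion tree i j → i ∈ anc j × i ≢ top × j Fin.< i
      ⇒ (i≢r , _ , (i≢j , i∈path) , j<i) with reverse⁻ {xs = j ∷ anc j} (subst (i ∈_) (vertices-from-top j) i∈path)
      ... | here i≡j   = contradiction i≡j i≢j
      ... | there i∈anc = i∈anc , i≢r , j<i

      ⇐ : i ∈ anc j × i ≢ top × j Fin.< i → IsInversion tree i j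
      ⇐ (i∈anc , i≢r , j<i) =
          i≢r
        , (λ { refl → contradiction (subst (i ∈_) anc-r i∈anc) λ () })
        , (<⇒≢ j<i ∘ sym , subst (i ∈_) (sym (vertices-from-top j)) (reverse⁺ {xs = j ∷ anc j} (there i∈anc)))
        , j<i

      mult≡1 : i ∈ anc j × i ≢ top × j Fin.< i → mult (complete n) (par tree i) j ≡ 1
      mult≡1 (i∈anc , i≢r , _) with par tree i ≟ j
      ... | no  _    = refl
      ... | yes refl with v , σ , eq ← ≢top⇒∷ i≢r =
        contradiction (ℕ.≤-trans (ℕ.≤-reflexive (sym (trans (depth-∷ eq) (cong (suc ∘ depth) (sym (par-tree eq))))))
                                 (ℕ.<⇒≤ (∈anc⇒depth< i∈anc))) (ℕ.<-irrefl refl)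

open AncestorMap

-- Induction along the ancestors in `N`. Let k be the parent of j in `N`; the edge between them is
-- in `M` too. Were j the parent of k in `M`, it would by induction be so in `N`, and j and k would
-- be each other's parents.
tree≈⇒parent≡ : ∀ {n} (M N : AncestorMap n) → tree M ≈ₜ tree N → ∀ j → parent M j ≡ parent N j
tree≈⇒parent≡ {n} M N M≈N j = go refl
  where
  open _≈ₜ_ M≈N
  go : ∀ {j σ} → anc N j ≡ σ → parent M j ≡ parent N j
  go {j} {[]} eq = trans (parent-[] M anc-j) (sym (parent-[] N eq))
    where
    anc-j : anc M j ≡ []
    anc-j = trans (cong (anc M) (trans (anc-[] N eq) (sym root-≡))) (anc-r M)
  go {j} {k ∷ σ} eq with edge⇒ M (trans (adj-≡ j k) (⇒edge N eq))
  ... | inj₁ (_ , eq′) = trans (parent-∷ M eq′) (sym (parent-∷ N eq))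
  ... | inj₂ (_ , eq′) = contradiction (trans (sym (go (anc-∷ N eq))) (parent-∷ M eq′)) (no-2-cycle refl)
    where
    no-2-cycle : ∀ {τ} → anc N k ≡ τ → parent N k ≢ j
    no-2-cycle {[]}    eq-k parent-k with refl ← trans (sym (parent-[] N eq-k)) parent-k =
      contradiction (trans (sym eq-k) eq) λ ()
    no-2-cycle {_ ∷ _} eq-k parent-k with refl ← trans (sym (parent-∷ N eq-k)) parent-k =
      contradiction (trans (depth-∷ N eq) (cong suc (depth-∷ N eq-k))) (ℕ.<⇒≢ (ℕ.m<n⇒m<1+n ℕ.≤-refl))

tree≈ : ∀ {n} (M : AncestorMap n) (T : RootedTree n) → top M ≡ root T →
        (∀ {j v σ} → anc M j ≡ v ∷ σ → par T j ≡ v) → tree M ≈ₜ T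
tree≈ M T top≡root parent≡par = record
  { root-≡ = top≡root
  ; adj-≡  = λ u v → ⇔→≡ {z = true} (mk⇔ ⇒ ⇐)
  }
  where
  par-edge : ∀ {u v σ} → anc M u ≡ v ∷ σ → adj (graph T) u v ≡ true
  par-edge {u} eq = subst (λ x → adj (graph T) u x ≡ true) (parent≡par eq)
    (par-adj T λ u≡r → contradiction
      (trans (sym (trans (cong (anc M) (trans u≡r (sym top≡root))) (anc-r M))) eq) λ ())

  parent-edge : ∀ {u v} → u ≢ root T → par T u ≡ v → adj (treeGraph M) u v ≡ true
  parent-edge u≢r refl with v , σ , eq ← ≢top⇒∷ M (λ u≡top → u≢r (trans u≡top top≡root))
    rewrite parent≡par eq = ⇒edge M eq

  ⇒ : ∀ {u v} → adj (treeGraph M) u v ≡ true → adj (graph T) u v ≡ true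
  ⇒ {u} {v} e with edge⇒ M e
  ... | inj₁ (_ , eq) = par-edge eq
  ... | inj₂ (_ , eq) = trans (adj-sym (graph T) u v) (par-edge eq)

  ⇐ : ∀ {u v} → adj (graph T) u v ≡ true → adj (treeGraph M) u v ≡ true
  ⇐ {u} {v} e with adj⇒par T e
  ... | inj₁ (u≢r , eq) = parent-edge u≢r eq
  ... | inj₂ (v≢r , eq) = trans (adj-sym (treeGraph M) u v) (parent-edge v≢r eq)

-- Depth-first burning

∑-zero : ∀ {n} {f : Fin n → ℕ} → (∀ i → f i ≡ 0) → ∑ f ≡ 0
∑-zero {zero}  _   = refl
∑-zero {suc n} f≡0 = cong₂ _+_ (f≡0 zero) (∑-zero (f≡0 ∘ suc))

∑-mono-≤ : ∀ {n} {f g : Fin n → ℕ} → (∀ i → f i ≤ g i) → ∑ f ≤ ∑ g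
∑-mono-≤ {zero}  _   = z≤n
∑-mono-≤ {suc n} f≤g = ℕ.+-mono-≤ (f≤g zero) (∑-mono-≤ (f≤g ∘ suc))

∑-change : ∀ {n} {f g : Fin n → ℕ} k {x} → (∀ i → i ≢ k → g i ≡ f i) → g k ≡ x + f k → ∑ g ≡ x + ∑ f
∑-change {suc n} {f} zero {x} g≡f gk≡ =
  trans (cong₂ _+_ gk≡ (∑ℕ.sum-cong-≗ λ i → g≡f (suc i) λ ())) (ℕ.+-assoc x (f zero) _)
∑-change {suc n} {f} {g} (suc k) {x} g≡f gk≡ =
  trans (cong₂ _+_ (g≡f zero λ ()) (∑-change {f = f ∘ suc} k (λ i i≢k → g≡f (suc i) (i≢k ∘ λ { refl → refl })) gk≡))
        (trans (sym (ℕ.+-assoc (f zero) x _)) (trans (cong (_+ ∑ (f ∘ suc)) (ℕ.+-comm (f zero) x)) (ℕ.+-assoc x _ _)))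

≔-inv : ∀ {a} {A : Set a} {n} (s : Vec A n) k j {x y} → lookup (s [ k ]≔ y) j ≡ x →
        (j ≡ k × y ≡ x) ⊎ (j ≢ k × lookup s j ≡ x)
≔-inv s k j {y = y} eq with j ≟ k
... | yes refl = inj₁ (refl , trans (sym (lookup∘update k s y)) eq)
... | no  j≢k  = inj₂ (j≢k , trans (sym (lookup∘update′ j≢k s y)) eq)

∑-≔ : ∀ {a} {A : Set a} {n} (F : Fin n → A → ℕ) (s : Vec A n) k {y x} →
      F k y ≡ x + F k (lookup s k) →
      ∑ (λ j → F j (lookup (s [ k ]≔ y) j)) ≡ x + ∑ (λ j → F j (lookup s j))
∑-≔ F s k {y} eq = ∑-change k
  (λ i i≢k → cong (F i) (lookup∘update′ i≢k s y)) (trans (cong (F k) (lookup∘update k s y)) eq)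

-- Labels are asked in decreasing order, so this indicates whether j is still on a list that has the
-- labels smaller than `m` left.
below : ∀ {n} → Fin n → ℕ → ℕ
below j m = if does (toℕ j ℕ.<? m) then 1 else 0

below-< : ∀ {n} (j : Fin n) {m} → toℕ j < m → below j m ≡ 1
below-< j {m} j<m = if-does-yes (toℕ j ℕ.<? m) j<m

below-≮ : ∀ {n} (j : Fin n) {m} → ¬ toℕ j < m → below j m ≡ 0
below-≮ j {m} j≮m = if-does-no (toℕ j ℕ.<? m) j≮m

below-suc : ∀ {n} (j : Fin n) {m} → toℕ j ≢ m → below j (suc m) ≡ below j m
below-suc j {m} j≢m = if-does-cong (toℕ j ℕ.<? suc m) (toℕ j ℕ.<? m)
  (λ j<1+m → ℕ.≤∧≢⇒< (ℕ.≤-pred j<1+m) j≢m) ℕ.m<n⇒m<1+n λ _ → refl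

inversions-∷ : ∀ {n} (r j k : Fin n) {σ} → k ∉ σ → k ≢ r →
               inversions r j (k ∷ σ) ≡ below j (toℕ k) + inversions r j σ
inversions-∷ r j k {σ} k∉σ k≢r = ∑-change k
  (λ i i≢k → if-does-cong (i ∈? k ∷ σ ×-dec ¬? (i ≟ r) ×-dec j <? i) (i ∈? σ ×-dec ¬? (i ≟ r) ×-dec j <? i)
    (λ { (here i≡k , _) → contradiction i≡k i≢k ; (there i∈σ , rest) → i∈σ , rest })
    (λ (i∈σ , rest) → there i∈σ , rest) λ _ → refl)
  (trans (if-does-cong (k ∈? k ∷ σ ×-dec ¬? (k ≟ r) ×-dec j <? k) (toℕ j ℕ.<? toℕ k)
            (proj₂ ∘ proj₂) (λ j<k → here refl , k≢r , j<k) λ _ → refl)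
         (trans (sym (ℕ.+-identityʳ _)) (cong (_+_ (below j (toℕ k))) (sym
           (if-does-no (k ∈? σ ×-dec ¬? (k ≟ r) ×-dec j <? k) (k∉σ ∘ proj₁))))))

inversions-[] : ∀ {n} (r j : Fin n) → inversions r j [] ≡ 0
inversions-[] r j = ∑-zero {f = λ i → if does (i ∈? [] ×-dec ¬? (i ≟ r) ×-dec j <? i) then 1 else 0} λ _ → refl

inversions-root : ∀ {n} (r j : Fin n) → inversions r j (r ∷ []) ≡ 0
inversions-root r j = ∑-zero λ i →
  if-does-no (i ∈? r ∷ [] ×-dec ¬? (i ≟ r) ×-dec j <? i) λ { (here i≡r , i≢r , _) → i≢r i≡r }

-- The list is then m - 1, ..., 0, so `m` alone determines which labels are left to ask.
data Descending {n} : ℕ → List (Fin n) → Set where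
  []  : Descending 0 []
  _∷_ : ∀ {k m L} → toℕ k ≡ m → Descending m L → Descending (suc m) (k ∷ L)

descending-∈ : ∀ {n m L} {j : Fin n} → Descending m L → j ∈ L → toℕ j < m
descending-∈ (refl ∷ _) (here refl) = ℕ.≤-refl
descending-∈ (_ ∷ L↓)   (there j∈)  = ℕ.m<n⇒m<1+n (descending-∈ L↓ j∈)

∈-descending : ∀ {n m L} {j : Fin n} → Descending m L → toℕ j < m → j ∈ L
∈-descending {j = j} (_∷_ {k} {m} k≡m L↓) j<1+m with toℕ j ℕ.≟ m
... | yes j≡m = here (toℕ-injective (trans j≡m (sym k≡m)))
... | no  j≢m = there (∈-descending L↓ (ℕ.≤∧≢⇒< (ℕ.≤-pred j<1+m) j≢m))

labels : ∀ n → List (Fin n)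
labels zero    = []
labels (suc n) = fromℕ n ∷ List.map inject₁ (labels n)

labels-descending : ∀ n → Descending n (labels n)
labels-descending zero    = []
labels-descending (suc n) = toℕ-fromℕ n ∷ lift (labels-descending n)
  where
  lift : ∀ {n m L} → Descending {n} m L → Descending m (List.map inject₁ L)
  lift []         = []
  lift (k≡m ∷ L↓) = trans (toℕ-inject₁ _) k≡m ∷ lift L↓

-- Each vertex carries the number of times it resisted; a burnt one also its proper ancestors in the tree.
data Status (n : ℕ) : Set where
  unburnt : ℕ → Status n
  burnt   : ℕ → List (Fin n) → Status n

State : ℕ → Set
State n = Vec (Status n) n

tally : ∀ {n} → Status n → ℕ
tally (unburnt c) = c
tally (burnt c _) = c

ancestors : ∀ {n} → Status n → List (Fin n)
ancestors (unburnt _) = []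
ancestors (burnt _ τ) = τ

heat : ∀ {n} → Status n → ℕ
heat (unburnt _) = 0
heat (burnt _ _) = 1

#burnt : ∀ {n} → State n → ℕ
#burnt s = ∑ λ j → heat (lookup s j)

data Burnt {n} (s : State n) (j : Fin n) : Set where
  burnt : ∀ {c τ} → lookup s j ≡ burnt c τ → Burnt s j

data Unburnt {n} (s : State n) (j : Fin n) : Set where
  unburnt : ∀ {c} → lookup s j ≡ unburnt c → Unburnt s j

burnt? : ∀ {n} (s : State n) j → Burnt s j ⊎ Unburnt s j
burnt? s j with lookup s j in eq
... | unburnt _ = inj₂ (unburnt eq)
... | burnt _ _ = inj₁ (burnt eq)

unburnt⇒¬burnt : ∀ {n} {s : State n} {j} → Unburnt s j → ¬ Burnt s j
unburnt⇒¬burnt (unburnt eq) (burnt eq′) = contradiction (trans (sym eq) eq′) λ ()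

infix 4 _⊑_ _⊑ˢ_
-- The order of time: resistances only accumulate, and a burnt vertex keeps its count and its
-- ancestors for good.
data _⊑_ {n} : Status n → Status n → Set where
  unburnt : ∀ {c c′} → c ≤ c′ → unburnt c ⊑ unburnt c′
  ignite  : ∀ {c c′ τ} → c ≤ c′ → unburnt c ⊑ burnt c′ τ
  burnt   : ∀ {c τ} → burnt c τ ⊑ burnt c τ

⊑-refl : ∀ {n} {x : Status n} → x ⊑ x
⊑-refl {x = unburnt _} = unburnt ℕ.≤-refl
⊑-refl {x = burnt _ _} = burnt

⊑-trans : ∀ {n} {x y z : Status n} → x ⊑ y → y ⊑ z → x ⊑ z
⊑-trans (unburnt p) (unburnt q) = unburnt (ℕ.≤-trans p q)
⊑-trans (unburnt p) (ignite q)  = ignite (ℕ.≤-trans p q)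
⊑-trans (ignite p)  burnt       = ignite p
⊑-trans burnt       burnt       = burnt

⊑⇒tally≤ : ∀ {n} {x y : Status n} → x ⊑ y → tally x ≤ tally y
⊑⇒tally≤ (unburnt p) = p
⊑⇒tally≤ (ignite p)  = p
⊑⇒tally≤ burnt       = ℕ.≤-refl

⊑⇒heat≤ : ∀ {n} {x y : Status n} → x ⊑ y → heat x ≤ heat y
⊑⇒heat≤ (unburnt _) = z≤n
⊑⇒heat≤ (ignite _)  = z≤n
⊑⇒heat≤ burnt       = ℕ.≤-refl

record _⊑ˢ_ {n} (s t : State n) : Set where
  constructor ⟪_⟫
  field at : ∀ j → lookup s j ⊑ lookup t j

open _⊑ˢ_

⊑ˢ-trans : ∀ {n} {s t u : State n} → s ⊑ˢ t → t ⊑ˢ u → s ⊑ˢ u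
⊑ˢ-trans s⊑t t⊑u = ⟪ (λ j → ⊑-trans (at s⊑t j) (at t⊑u j)) ⟫

⊑-≔ : ∀ {n} {s : State n} {k x y} → lookup s k ≡ x → x ⊑ y → s ⊑ˢ s [ k ]≔ y
⊑-≔ {s = s} {k} {y = y} refl x⊑y = ⟪ pointwise ⟫
  where
  pointwise : ∀ j → lookup s j ⊑ lookup (s [ k ]≔ y) j
  pointwise j with j ≟ k
  ... | yes refl rewrite lookup∘update k s y    = x⊑y
  ... | no  j≢k  rewrite lookup∘update′ j≢k s y = ⊑-refl

⊑ˢ-burnt : ∀ {n} {s t : State n} {j c τ} → s ⊑ˢ t → lookup s j ≡ burnt c τ → lookup t j ≡ burnt c τ
⊑ˢ-burnt {s = s} {t} {j} s⊑t eq with lookup s j | lookup t j | at s⊑t j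
⊑ˢ-burnt s⊑t refl | _ | _ | burnt = refl

⊑ˢ-Burnt : ∀ {n} {s t : State n} {j} → s ⊑ˢ t → Burnt s j → Burnt t j
⊑ˢ-Burnt s⊑t (burnt eq) = burnt (⊑ˢ-burnt s⊑t eq)

≔-unburnt-¬Burnt : ∀ {n} {s : State n} {k j c} → ¬ Burnt s j → ¬ Burnt (s [ k ]≔ unburnt c) j
≔-unburnt-¬Burnt {s = s} {k} {j} ¬burnt (burnt eq) with ≔-inv s k j eq
... | inj₂ (_ , eq′) = ¬burnt (burnt eq′)

≔-¬Burnt : ∀ {n} {s : State n} {k j y} → j ≢ k → ¬ Burnt s j → ¬ Burnt (s [ k ]≔ y) j
≔-¬Burnt {s = s} {k} {j} j≢k ¬burnt (burnt eq) with ≔-inv s k j eq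
... | inj₁ (j≡k , _)  = j≢k j≡k
... | inj₂ (_ , eq′) = ¬burnt (burnt eq′)

#burnt-ignite : ∀ {n} {s : State n} {k c c′ τ} → lookup s k ≡ unburnt c →
                #burnt (s [ k ]≔ burnt c′ τ) ≡ suc (#burnt s)
#burnt-ignite {s = s} {k} eq = ∑-≔ (λ _ → heat) s k (cong (suc ∘ heat) (sym eq))

#burnt-resist : ∀ {n} {s : State n} {k c c′} → lookup s k ≡ unburnt c → #burnt (s [ k ]≔ unburnt c′) ≡ #burnt s
#burnt-resist {s = s} {k} eq = ∑-≔ (λ _ → heat) s k (cong heat (sym eq))

∑-one : ∀ n → ∑ {n} (λ _ → 1) ≡ n
∑-one zero    = refl
∑-one (suc n) = cong suc (∑-one n)

#burnt≤n : ∀ {n} (s : State n) → #burnt s ≤ n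
#burnt≤n {n} s = ℕ.≤-trans (∑-mono-≤ {g = λ _ → 1} λ j → heat≤1 (lookup s j)) (ℕ.≤-reflexive (∑-one n))
  where
  heat≤1 : ∀ (x : Status n) → heat x ≤ 1
  heat≤1 (unburnt _) = z≤n
  heat≤1 (burnt _ _) = ℕ.≤-refl

Oracle : ℕ → Set
Oracle n = Fin n → Fin n → ℕ → Bool

-- Run O v σ L s t: the burning vertex v, whose proper ancestors are σ, tries to ignite the labels
-- in L one after the other; a vertex j that has resisted c times catches fire iff O v j c holds,
-- and then burns completely before v goes on.
data Run {n} (O : Oracle n) (v : Fin n) (σ : List (Fin n)) : List (Fin n) → State n → State n → Set where
  done   : ∀ {s} → Run O v σ [] s s
  skip   : ∀ {j L s t c τ} → lookup s j ≡ burnt c τ → Run O v σ L s t → Run O v σ (j ∷ L) s t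
  resist : ∀ {j L s t c} → lookup s j ≡ unburnt c → O v j c ≡ false →
           Run O v σ L (s [ j ]≔ unburnt (suc c)) t → Run O v σ (j ∷ L) s t
  ignite : ∀ {j L s s′ t c} → lookup s j ≡ unburnt c → O v j c ≡ true →
           Run O j (v ∷ σ) (labels n) (s [ j ]≔ burnt c (v ∷ σ)) s′ → Run O v σ L s′ t → Run O v σ (j ∷ L) s t

module _ {n} {O : Oracle n} where

  run-⊑ : ∀ {v σ L s t} → Run O v σ L s t → s ⊑ˢ t
  run-⊑ done               = ⟪ (λ _ → ⊑-refl) ⟫
  run-⊑ (skip _ ρ)         = run-⊑ ρ
  run-⊑ (resist eq _ ρ)    = ⊑ˢ-trans (⊑-≔ eq (unburnt (ℕ.n≤1+n _))) (run-⊑ ρ)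
  run-⊑ (ignite eq _ ρ ρ′) = ⊑ˢ-trans (⊑-≔ eq (ignite ℕ.≤-refl)) (⊑ˢ-trans (run-⊑ ρ) (run-⊑ ρ′))

  private
    -- Each ignition recurses on a full list of labels, but with one more burnt vertex. At most n
    -- vertices burn, so fuel that exceeds n - `#burnt s` bounds the nesting.
    Burnable : ℕ → Set
    Burnable fuel = ∀ {v σ s} → n < fuel + #burnt s → ∃[ t ] Run O v σ (labels n) s t

    run-list : ∀ {fuel} → Burnable fuel → ∀ {v σ} L s → n ≤ fuel + #burnt s → ∃[ t ] Run O v σ L s t
    run-list burn []      s _ = s , done
    run-list {fuel} burn {v} {σ} (j ∷ L) s enough with lookup s j in eq
    ... | burnt _ _ with t , ρ ← run-list burn L s enough = t , skip eq ρ
    ... | unburnt c with O v j c in answer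
    ...   | false
      with t , ρ ← run-list burn L (s [ j ]≔ unburnt (suc c))
                     (subst (λ b → n ≤ fuel + b) (sym (#burnt-resist {s = s} eq)) enough)
      = t , resist eq answer ρ
    ...   | true
      with s′ , ρ ← burn {j} {v ∷ σ} {s [ j ]≔ burnt c (v ∷ σ)}
                      (ℕ.≤-trans (s≤s enough) (ℕ.≤-reflexive (trans (sym (ℕ.+-suc fuel _))
                        (cong (_+_ fuel) (sym (#burnt-ignite {s = s} eq))))))
      with t , ρ′ ← run-list burn L s′ (ℕ.≤-trans enough (ℕ.+-monoʳ-≤ fuel
                      (∑-mono-≤ (⊑⇒heat≤ ∘ at (⊑ˢ-trans (⊑-≔ {s = s} eq (ignite ℕ.≤-refl)) (run-⊑ ρ))))))
      = t , ignite eq answer ρ ρ′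

    burnable : ∀ fuel → Burnable fuel
    burnable zero       {s = s} enough = contradiction (ℕ.≤-trans enough (#burnt≤n s)) (ℕ.<-irrefl refl)
    burnable (suc fuel) {s = s} enough = run-list (burnable fuel) (labels n) s (ℕ.≤-pred enough)

  run-exists : ∀ v σ s → ∃[ t ] Run O v σ (labels n) s t
  run-exists v σ s = burnable (suc n) (s≤s (ℕ.m≤m+n n _))

private
  unburnt-injective : ∀ {n c c′} → Status.unburnt {n} c ≡ unburnt c′ → c ≡ c′
  unburnt-injective refl = refl

-- The status of the label and the answer select the rule. The oracles are compared pointwise, which
-- is how the parent functions of two equal trees agree.
run-deterministic : ∀ {n} {O O′ : Oracle n} → (∀ v j c → O v j c ≡ O′ v j c) →
                    ∀ {v σ L s t t′} → Run O v σ L s t → Run O′ v σ L s t′ → t ≡ t′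
run-deterministic O≗O′ done done = refl
run-deterministic O≗O′ (skip _ ρ)   (skip _ ρ₁)        = run-deterministic O≗O′ ρ ρ₁
run-deterministic O≗O′ (skip e _)   (resist e′ _ _)    = contradiction (trans (sym e) e′) λ ()
run-deterministic O≗O′ (skip e _)   (ignite e′ _ _ _)  = contradiction (trans (sym e) e′) λ ()
run-deterministic O≗O′ (resist e _ _)   (skip e′ _)    = contradiction (trans (sym e) e′) λ ()
run-deterministic O≗O′ (ignite e _ _ _) (skip e′ _)    = contradiction (trans (sym e) e′) λ ()
run-deterministic O≗O′ (resist e _ ρ) (resist e′ _ ρ₁)
  with refl ← unburnt-injective (trans (sym e) e′) = run-deterministic O≗O′ ρ ρ₁
run-deterministic O≗O′ {v} (resist {j} {c = c} e rejected ρ) (ignite e′ accepted _ _)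
  with refl ← unburnt-injective (trans (sym e) e′) =
  contradiction (trans (sym rejected) (trans (O≗O′ v j c) accepted)) λ ()
run-deterministic O≗O′ {v} (ignite {j} {c = c} e accepted _ _) (resist e′ rejected _)
  with refl ← unburnt-injective (trans (sym e) e′) =
  contradiction (trans (sym accepted) (trans (O≗O′ v j c) rejected)) λ ()
run-deterministic O≗O′ (ignite e _ ρ ρ′) (ignite e′ _ ρ₁ ρ₁′)
  with refl ← unburnt-injective (trans (sym e) e′)
  with refl ← run-deterministic O≗O′ ρ ρ₁ = run-deterministic O≗O′ ρ′ ρ₁′

-- The invariant of the fire

module _ {n} (r : Fin n) where

  -- For a burnt vertex other than the root, with `suc c` in the role of p_j: the entry plus the
  -- inversions at j, which `ignition-balance` equates with the number of vertices burnt before j.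
  weight : Fin n → Status n → ℕ
  weight _ (unburnt _)       = 0
  weight _ (burnt _ [])      = 0
  weight j (burnt c (v ∷ σ)) = suc c + inversions r j (v ∷ σ)

  -- `balance` accounts for the burnt vertices: each has failed to ignite j, or is v with j still on
  -- its list, or is waiting for a child i > j on the way to v, and will then come back to j < i.
  record Invariant (v : Fin n) (σ : List (Fin n)) (m : ℕ) (s : State n) : Set where
    field
      at-root   : lookup s r ≡ burnt 0 []
      only-root : ∀ {j c} → lookup s j ≡ burnt c [] → j ≡ r
      chain     : ∀ {j c x τ} → lookup s j ≡ burnt c (x ∷ τ) → ∃[ c′ ] lookup s x ≡ burnt c′ τ
      current   : ∃[ c ] lookup s v ≡ burnt c σ
      balance   : ∀ {j c} → lookup s j ≡ unburnt c → c + below j m + inversions r j (v ∷ σ) ≡ #burnt s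
      total     : ∑ (λ j → weight j (lookup s j)) ≡ #burnt s C 2

    unburnt≢root : ∀ {k c} → lookup s k ≡ unburnt c → k ≢ r
    unburnt≢root eq refl = contradiction (trans (sym eq) at-root) λ ()

    unburnt∉current : ∀ {k c} → lookup s k ≡ unburnt c → k ∉ v ∷ σ
    unburnt∉current {k} eq = go (proj₂ current)
      where
      go : ∀ {x c τ} → lookup s x ≡ burnt c τ → k ∉ x ∷ τ
      go eq′ (here refl) = contradiction (trans (sym eq) eq′) λ ()
      go {τ = _ ∷ _} eq′ (there k∈τ) = go (proj₂ (chain eq′)) k∈τ

  open Invariant

  module _ {v : Fin n} {σ : List (Fin n)} {m : ℕ} {s : State n} {k : Fin n} (k≡m : toℕ k ≡ m) where

    private
      ≢⇒below : ∀ {j} → j ≢ k → below j (suc m) ≡ below j m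
      ≢⇒below {j} j≢k = below-suc j λ j≡m → j≢k (toℕ-injective (trans j≡m (sym k≡m)))

    invariant-skip : ∀ {c τ} → lookup s k ≡ burnt c τ → Invariant v σ (suc m) s → Invariant v σ m s
    invariant-skip eq I = record
      { at-root   = at-root I
      ; only-root = only-root I
      ; chain     = chain I
      ; current   = current I
      ; balance   = λ {j} {c′} eq′ → trans
          (cong (λ b → c′ + b + inversions r j (v ∷ σ))
            (sym (≢⇒below {j} λ { refl → contradiction (trans (sym eq) eq′) λ () })))
          (balance I eq′)
      ; total     = total I
      }

    -- The resistance that k gains makes up for its lost place on the list of v.
    invariant-resist : ∀ {c} → lookup s k ≡ unburnt c → Invariant v σ (suc m) s →
                       Invariant v σ m (s [ k ]≔ unburnt (suc c))
    invariant-resist {c} eq I = record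
      { at-root   = kept (at-root I)
      ; only-root = only-root I ∘ old
      ; chain     = λ eq′ → let c′ , eq″ = chain I (old eq′) in c′ , kept eq″
      ; current   = proj₁ (current I) , kept (proj₂ (current I))
      ; balance   = balanced
      ; total     = trans (∑-≔ weight s k (cong (weight k) (sym eq)))
                          (trans (total I) (cong (_C 2) (sym (#burnt-resist {s = s} eq))))
      }
      where
      s′ = s [ k ]≔ unburnt (suc c)

      kept : ∀ {j c′ τ} → lookup s j ≡ burnt c′ τ → lookup s′ j ≡ burnt c′ τ
      kept {j} = ⊑ˢ-burnt {j = j} (⊑-≔ {s = s} eq (unburnt (ℕ.n≤1+n c)))

      old : ∀ {j c′ τ} → lookup s′ j ≡ burnt c′ τ → lookup s j ≡ burnt c′ τ
      old {j} eq′ with ≔-inv s k j eq′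
      ... | inj₂ (_ , eq″) = eq″

      balanced : ∀ {j c′} → lookup s′ j ≡ unburnt c′ → c′ + below j m + inversions r j (v ∷ σ) ≡ #burnt s′
      balanced {j} {c′} eq′ with ≔-inv s k j eq′
      ... | inj₁ (refl , refl) = trans (cong (_+ inversions r k (v ∷ σ)) tallies)
                                       (trans (balance I eq) (sym (#burnt-resist {s = s} eq)))
        where
        tallies : suc c + below k m ≡ c + below k (suc m)
        tallies = trans (cong (_+_ (suc c)) (below-≮ k (ℕ.<-irrefl k≡m)))
          (trans (sym (ℕ.+-suc c 0)) (cong (_+_ c) (sym (below-< k (s≤s (ℕ.≤-reflexive k≡m))))))
      ... | inj₂ (j≢k , eq″)   = trans (cong (λ b → c′ + b + inversions r j (v ∷ σ)) (sym (≢⇒below j≢k)))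
                                       (trans (balance I eq″) (sym (#burnt-resist {s = s} eq)))

    -- The vertex k is still on the list when asked, which supplies the 1 in `suc c`.
    ignition-balance : ∀ {c} → lookup s k ≡ unburnt c → Invariant v σ (suc m) s →
                       suc c + inversions r k (v ∷ σ) ≡ #burnt s
    ignition-balance {c} eq I = trans (cong (_+ inversions r k (v ∷ σ))
      (trans (ℕ.+-comm 1 c) (cong (_+_ c) (sym (below-< k (s≤s (ℕ.≤-reflexive k≡m))))))) (balance I eq)

    -- One more vertex burns. For an unburnt j other than k, the additional 1 is its place on the
    -- fresh list of k; its place on the list of v, present exactly when j < k, is now counted as
    -- the inversion (k , j).
    invariant-ignite : ∀ {c} → lookup s k ≡ unburnt c → Invariant v σ (suc m) s →
                       Invariant k (v ∷ σ) n (s [ k ]≔ burnt c (v ∷ σ))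
    invariant-ignite {c} eq I = record
      { at-root   = kept (at-root I)
      ; only-root = only
      ; chain     = chained
      ; current   = c , lookup∘update k s _
      ; balance   = balanced
      -- The weight of `k` is the number b of vertices burnt before it, so the total grows from b
      -- choose 2 to (b + 1) choose 2 by Pascal's rule.
      ; total     = trans (∑-≔ weight s k (trans (ignition-balance eq I)
                             (trans (sym (ℕ.+-identityʳ _)) (cong (λ x → #burnt s + weight k x) (sym eq)))))
                   (trans (cong (_+_ (#burnt s)) (total I))
                   (trans (cong (_+ #burnt s C 2) (sym (nC1≡n (#burnt s))))
                   (trans (nCk+nC[k+1]≡[n+1]C[k+1] (#burnt s) 1)
                          (cong (_C 2) (sym (#burnt-ignite {s = s} eq))))))
      }
      where
      s′ = s [ k ]≔ burnt c (v ∷ σ)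

      kept : ∀ {j c′ τ} → lookup s j ≡ burnt c′ τ → lookup s′ j ≡ burnt c′ τ
      kept {j} = ⊑ˢ-burnt {j = j} (⊑-≔ {s = s} eq (ignite ℕ.≤-refl))

      only : ∀ {j c′} → lookup s′ j ≡ burnt c′ [] → j ≡ r
      only {j} eq′ with ≔-inv s k j eq′
      ... | inj₂ (_ , eq″) = only-root I eq″

      chained : ∀ {j c′ x τ} → lookup s′ j ≡ burnt c′ (x ∷ τ) → ∃[ c″ ] lookup s′ x ≡ burnt c″ τ
      chained {j} eq′ with ≔-inv s k j eq′
      ... | inj₁ (refl , refl) = proj₁ (current I) , kept (proj₂ (current I))
      ... | inj₂ (_ , eq″)     = let c″ , eq‴ = chain I eq″ in c″ , kept eq‴

      balanced : ∀ {j c′} → lookup s′ j ≡ unburnt c′ → c′ + below j n + inversions r j (k ∷ v ∷ σ) ≡ #burnt s′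
      balanced {j} {c′} eq′ with ≔-inv s k j eq′
      ... | inj₂ (j≢k , eq″) = trans rearranged (trans (cong suc (balance I eq″)) (sym (#burnt-ignite {s = s} eq)))
        where
        rearranged : c′ + below j n + inversions r j (k ∷ v ∷ σ)
                     ≡ suc (c′ + below j (suc m) + inversions r j (v ∷ σ))
        rearranged
          rewrite below-< j (toℕ<n j) | inversions-∷ r j k (unburnt∉current I eq) (unburnt≢root I eq)
                | ≢⇒below j≢k | k≡m | ℕ.+-comm c′ 1 = cong suc (sym (ℕ.+-assoc c′ _ _))

    -- The reverse exchange: the list of k is exhausted, and the inversion (k , j) turns back into
    -- the place of j on the list of v.
    invariant-return : k ∉ v ∷ σ → k ≢ r → Invariant k (v ∷ σ) 0 s → Invariant v σ m s
    invariant-return k∉ k≢r I = record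
      { at-root   = at-root I
      ; only-root = only-root I
      ; chain     = chain I
      ; current   = chain I (proj₂ (current I))
      ; balance   = balanced
      ; total     = total I
      }
      where
      balanced : ∀ {j c′} → lookup s j ≡ unburnt c′ → c′ + below j m + inversions r j (v ∷ σ) ≡ #burnt s
      balanced {j} {c′} eq = trans rearranged (balance I eq)
        where
        rearranged : c′ + below j m + inversions r j (v ∷ σ) ≡ c′ + 0 + inversions r j (k ∷ v ∷ σ)
        rearranged rewrite inversions-∷ r j k k∉ k≢r | k≡m | ℕ.+-identityʳ c′ = ℕ.+-assoc c′ _ _

  invariant-run : ∀ {O v σ m L s t} → Descending m L → Invariant v σ m s → Run O v σ L s t → Invariant v σ 0 t
  invariant-run []         I done            = I
  invariant-run (k≡m ∷ L↓) I (skip eq ρ)     = invariant-run L↓ (invariant-skip k≡m eq I) ρ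
  invariant-run (k≡m ∷ L↓) I (resist eq _ ρ) = invariant-run L↓ (invariant-resist k≡m eq I) ρ
  invariant-run (k≡m ∷ L↓) I (ignite eq _ ρ ρ′) =
    invariant-run L↓ (invariant-return k≡m (unburnt∉current I eq) (unburnt≢root I eq)
      (invariant-run (labels-descending n) (invariant-ignite k≡m eq I) ρ)) ρ′

  start : State n
  start = Vec.replicate n (unburnt 0) [ r ]≔ burnt 0 []

  start-unburnt : ∀ {j} → j ≢ r → lookup start j ≡ unburnt 0
  start-unburnt {j} j≢r = trans (lookup∘update′ j≢r (Vec.replicate n (unburnt 0)) _) (lookup-replicate j _)

  start-burnt : ∀ {j c τ} → lookup start j ≡ burnt c τ → j ≡ r × burnt {n} 0 [] ≡ burnt c τ
  start-burnt {j} eq with ≔-inv (Vec.replicate n (unburnt 0)) r j eq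
  ... | inj₁ (j≡r , eq′) = j≡r , eq′
  ... | inj₂ (_ , eq′)   = contradiction (trans (sym (lookup-replicate j (unburnt 0))) eq′) λ ()

  invariant-start : Invariant r [] n start
  invariant-start = record
    { at-root   = lookup∘update r (Vec.replicate n (unburnt 0)) _
    ; only-root = proj₁ ∘ start-burnt
    ; chain     = λ eq → contradiction (proj₂ (start-burnt eq)) λ ()
    ; current   = 0 , lookup∘update r (Vec.replicate n (unburnt 0)) _
    ; balance   = balanced
    ; total     = trans (∑-zero weightless) (cong (_C 2) (sym one-burnt))
    }
    where
    one-burnt : #burnt start ≡ 1
    one-burnt = trans
      (∑-≔ (λ _ → heat) (Vec.replicate n (unburnt 0)) r (cong (suc ∘ heat) (sym (lookup-replicate r (unburnt 0)))))
      (cong suc (∑-zero {n} λ j → cong heat (lookup-replicate j (unburnt 0))))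

    weightless : ∀ j → weight j (lookup start j) ≡ 0
    weightless j with j ≟ r
    ... | yes refl = cong (weight r) (lookup∘update r (Vec.replicate n (unburnt 0)) _)
    ... | no  j≢r  = cong (weight j) (start-unburnt j≢r)

    balanced : ∀ {j c} → lookup start j ≡ unburnt c → c + below j n + inversions r j (r ∷ []) ≡ #burnt start
    balanced {j} eq with ≔-inv (Vec.replicate n (unburnt 0)) r j eq
    ... | inj₂ (_ , eq′) with refl ← trans (sym (lookup-replicate j (unburnt 0))) eq′ =
      trans (cong₂ _+_ (below-< j (toℕ<n j)) (inversions-root r j)) (sym one-burnt)

open Invariant

-- Fire steered by a vector: sphericity means that everything burns

does-true : ∀ {p} {P : Set p} (P? : Dec P) → does P? ≡ true → P
does-true (yes p) _ = p

does-false : ∀ {p} {P : Set p} (P? : Dec P) → does P? ≡ false → ¬ P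
does-false (no ¬p) _ = ¬p

countOracle : ∀ {n} → Vec ℕ n → Oracle n
countOracle p _ j c = does (lookup p j ℕ.≟ suc c)

treeOracle : ∀ {n} → (Fin n → Fin n) → Oracle n
treeOracle f v j _ = does (f j ≟ v)

Obeys : ∀ {n} → ℕ → Status n → Set
Obeys x (unburnt c) = suc c ≤ x
Obeys x (burnt c _) = x ≡ suc c

module _ {n} (p : Vec ℕ n) where

  obeys-≔ : ∀ (s : State n) {k y} → (∀ j → Obeys (lookup p j) (lookup s j)) → Obeys (lookup p k) y →
            ∀ j → Obeys (lookup p j) (lookup (s [ k ]≔ y) j)
  obeys-≔ s {k} {y} s-obeys y-obeys j with j ≟ k
  ... | yes refl rewrite lookup∘update k s y    = y-obeys
  ... | no  j≢k  rewrite lookup∘update′ j≢k s y = s-obeys j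

  obeys-run : ∀ {v σ L s t} → Run (countOracle p) v σ L s t →
              (∀ j → Obeys (lookup p j) (lookup s j)) → ∀ j → Obeys (lookup p j) (lookup t j)
  obeys-run done       obeys = obeys
  obeys-run (skip _ ρ) obeys = obeys-run ρ obeys
  obeys-run (resist {j} {s = s} {c = c} eq rejected ρ) obeys = obeys-run ρ (obeys-≔ s obeys
    (ℕ.≤∧≢⇒< (subst (Obeys (lookup p j)) eq (obeys j)) (does-false (lookup p j ℕ.≟ suc c) rejected ∘ sym)))
  obeys-run (ignite {j} {s = s} {c = c} eq accepted ρ ρ′) obeys =
    obeys-run ρ′ (obeys-run ρ (obeys-≔ s obeys (does-true (lookup p j ℕ.≟ suc c) accepted)))

  obeys-start : ∀ {r} → (∀ j → 1 ≤ lookup p j) → lookup p r ≡ 1 → ∀ j → Obeys (lookup p j) (lookup (start r) j)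
  obeys-start {r} positive p-r = obeys-≔ (Vec.replicate n (unburnt 0))
    (λ j → subst (Obeys (lookup p j)) (sym (lookup-replicate j (unburnt 0))) (positive j)) p-r

isUnburnt : ∀ {n} → Status n → Bool
isUnburnt (unburnt _) = true
isUnburnt (burnt _ _) = false

∣unburnt∣ : ∀ {n} (s : State n) → ∣ Vec.map isUnburnt s ∣ + #burnt s ≡ n
∣unburnt∣ {n} s = trans (ℕ.+-comm ∣ Vec.map isUnburnt s ∣ _)
  (trans (cong (_+ ∣ Vec.map isUnburnt s ∣) (∑ℕ.sum-cong-≗ pointwise)) (∑-outside (Vec.map isUnburnt s)))
  where
  pointwise : ∀ j → heat (lookup s j) ≡ (if lookup (Vec.map isUnburnt s) j then 0 else 1)
  pointwise j rewrite lookup-map j isUnburnt s with lookup s j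
  ... | unburnt _ = refl
  ... | burnt _ _ = refl

module _ {n} {r : Fin n} (p : Vec ℕ n) {t : State n} where

  -- Let A be the set of vertices left unburnt, if any. Each has resisted all b = n - |A| burnt
  -- vertices, so its entry is at least b + 1, contradicting sphericity; A is proper as it misses
  -- the root.
  spherical⇒all-burnt : IsSpherical p → lookup p r ≡ 1 →
                        Run (countOracle p) r [] (labels n) (start r) t → ∀ j → Burnt t j
  spherical⇒all-burnt (positive , not-exceeding) p-r ρ j with burnt? t j
  ... | inj₁ j-burnt        = j-burnt
  ... | inj₂ (unburnt j-eq) = contradiction exceeds (not-exceeding A (j , lookup⇒[]= j A j∈A) ∣A∣<n)
    where
    I = invariant-run r (labels-descending n) (invariant-start r) ρ
    A = Vec.map isUnburnt t

    j∈A : lookup A j ≡ true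
    j∈A = trans (lookup-map j isUnburnt t) (cong isUnburnt j-eq)

    tally≡#burnt : ∀ {i c} → lookup t i ≡ unburnt c → c ≡ #burnt t
    tally≡#burnt {i} {c} eq = trans (sym (trans (ℕ.+-identityʳ (c + 0)) (ℕ.+-identityʳ c)))
      (trans (cong (_+_ (c + 0)) (sym (inversions-root r i))) (balance I eq))

    ∣A∣<n : ∣ A ∣ < n
    ∣A∣<n = subst (∣ A ∣ <_) (∣unburnt∣ t) (ℕ.m<m+n ∣ A ∣ (1≤#burnt t r (at-root I)))
      where
      1≤#burnt : ∀ {m k} (s : Vec (Status k) m) i {c τ} → lookup s i ≡ burnt c τ → 1 ≤ ∑ (λ j → heat (lookup s j))
      1≤#burnt (_ Vec.∷ s) zero    refl = s≤s z≤n
      1≤#burnt (x Vec.∷ s) (suc i) eq   = ℕ.≤-trans (1≤#burnt s i eq) (ℕ.m≤n+m _ (heat x))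

    exceeds : Exceeds p A
    exceeds i i∈A with lookup t i in eq | obeys-run p ρ (obeys-start p positive p-r) i
                       | trans (sym (lookup-map i isUnburnt t)) i∈A
    ... | unburnt c | c<p | _ = ℕ.≤-trans
      (ℕ.≤-reflexive (cong suc (trans (sym (∣unburnt∣ t))
        (trans (cong (_+_ ∣ A ∣) (sym (tally≡#burnt eq))) (ℕ.+-comm ∣ A ∣ c)))))
      (ℕ.+-monoˡ-≤ ∣ A ∣ c<p)
    ... | burnt _ _ | _ | i∈A′ = contradiction i∈A′ λ ()

module _ {n} {r : Fin n} (p : Vec ℕ n) (A : Subset n) (exceeds : Exceeds p A) where

  private
    Avoids : State n → Set
    Avoids s = ∀ {j} → lookup A j ≡ true → Unburnt s j

    avoids-≔ : ∀ {s k y} → Avoids s → (lookup A k ≡ true → ∃[ c ] y ≡ unburnt c) → Avoids (s [ k ]≔ y)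
    avoids-≔ {s} {k} {y} avoids y-unburnt {j} j∈A with j ≟ k
    ... | yes refl = let c , eq = y-unburnt j∈A in unburnt (trans (lookup∘update k s y) eq)
    ... | no  j≢k with unburnt eq ← avoids j∈A = unburnt (trans (lookup∘update′ j≢k s y) eq)

    ∣A∣+#burnt≤n : ∀ s → Avoids s → #burnt s + ∣ A ∣ ≤ n
    ∣A∣+#burnt≤n s avoids = ℕ.≤-trans
      (ℕ.+-monoˡ-≤ ∣ A ∣ (∑-mono-≤ {g = λ j → if lookup A j then 0 else 1} pointwise))
      (ℕ.≤-reflexive (∑-outside A))
      where
      pointwise : ∀ j → heat (lookup s j) ≤ (if lookup A j then 0 else 1)
      pointwise j with lookup A j in j∈A
      ... | true with unburnt eq ← avoids j∈A = ℕ.≤-reflexive (cong heat eq)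
      ... | false with lookup s j
      ...   | unburnt _ = z≤n
      ...   | burnt _ _ = ℕ.≤-refl

  -- For the first vertex k of A to burn, `ignition-balance` would bound p_k by the number b of
  -- burnt vertices, and b ≤ n - |A| since A is still unburnt, against p_k ≥ n + 1 - |A|.
  exceeding-unburnt : ∀ {v σ m L s t} → Descending m L → Invariant r v σ m s → Run (countOracle p) v σ L s t →
                      Avoids s → Avoids t
  exceeding-unburnt []         I done            avoids = avoids
  exceeding-unburnt (k≡m ∷ L↓) I (skip eq ρ)     avoids = exceeding-unburnt L↓ (invariant-skip r k≡m eq I) ρ avoids
  exceeding-unburnt (k≡m ∷ L↓) I (resist eq _ ρ) avoids =
    exceeding-unburnt L↓ (invariant-resist r k≡m eq I) ρ (avoids-≔ avoids λ _ → _ , refl)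
  exceeding-unburnt {s = s} (k≡m ∷ L↓) I (ignite {k} {c = c} eq accepted ρ ρ′) avoids =
    exceeding-unburnt L↓ (invariant-return r k≡m (unburnt∉current I eq) (unburnt≢root I eq)
        (invariant-run r (labels-descending n) (invariant-ignite r k≡m eq I) ρ)) ρ′
      (exceeding-unburnt (labels-descending n) (invariant-ignite r k≡m eq I) ρ
        (avoids-≔ avoids λ k∈A → contradiction (too-many k∈A) (ℕ.<-irrefl refl)))
    where
    too-many : lookup A k ≡ true → suc n ≤ n
    too-many k∈A = ℕ.≤-trans (exceeds k k∈A) (ℕ.≤-trans (ℕ.+-monoˡ-≤ ∣ A ∣ p≤#burnt) (∣A∣+#burnt≤n s avoids))
      where
      p≤#burnt : lookup p k ≤ #burnt s
      p≤#burnt = ℕ.≤-trans (ℕ.≤-reflexive (does-true (lookup p k ℕ.≟ suc c) accepted))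
        (ℕ.≤-trans (ℕ.m≤m+n (suc c) _) (ℕ.≤-reflexive (ignition-balance r k≡m eq I)))

all-burnt⇒spherical : ∀ {n} {r : Fin n} (p : Vec ℕ n) {t} → Run (countOracle p) r [] (labels n) (start r) t →
                      (∀ j → Burnt t j) → (∀ j → 1 ≤ lookup p j) → lookup p r ≡ 1 → IsSpherical p
all-burnt⇒spherical {n} {r} p {t} ρ all-burnt positive p-r = positive , not-exceeding
  where
  not-exceeding : ∀ A → Nonempty A → ∣ A ∣ < n → ¬ Exceeds p A
  not-exceeding A (i , i∈A) ∣A∣<n exceeds = unburnt⇒¬burnt
    (exceeding-unburnt p A exceeds (labels-descending n) (invariant-start r) ρ avoids-start ([]=⇒lookup i∈A)) (all-burnt i)
    where
    avoids-start : ∀ {j} → lookup A j ≡ true → Unburnt (start r) j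
    -- The root is not in A: its entry 1 is less than n + 1 - |A| because A is proper.
    avoids-start {j} j∈A = unburnt (start-unburnt r λ { refl → contradiction (exceeds r j∈A)
      (ℕ.<⇒≱ (subst (λ x → x + ∣ A ∣ < suc n) (sym p-r) (s≤s ∣A∣<n))) })

-- Fire steered by a tree: everything burns

module _ {n} {f : Fin n → Fin n} where

  private
    children : ∀ {v σ L s t} → Run (treeOracle f) v σ L s t → ∀ {j} → j ∈ L → f j ≡ v → Burnt t j
    children (skip eq ρ)        (here refl) _ = ⊑ˢ-Burnt (run-⊑ ρ) (burnt eq)
    children (skip _ ρ)         (there j∈)    = children ρ j∈
    children {v} (resist {j} _ rejected ρ) (here refl) fj≡v = contradiction fj≡v (does-false (f j ≟ v) rejected)
    children (resist _ _ ρ)     (there j∈)    = children ρ j∈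
    children (ignite {j} {s = s} _ _ ρ ρ′) (here refl) _ =
      ⊑ˢ-Burnt (⊑ˢ-trans (run-⊑ ρ) (run-⊑ ρ′)) (burnt (lookup∘update j s _))
    children (ignite _ _ _ ρ′)  (there j∈)    = children ρ′ j∈

    -- If the parent of j burns during the run, it does so at a nested ignition, where it asks all
    -- labels and j among them.
    grandchildren : ∀ {v σ L s t} → Run (treeOracle f) v σ L s t →
                    ∀ {j} → ¬ Burnt s (f j) → Burnt t (f j) → Burnt t j
    grandchildren done            ¬s t = contradiction t ¬s
    grandchildren (skip _ ρ)      ¬s t = grandchildren ρ ¬s t
    grandchildren (resist _ _ ρ)  ¬s t = grandchildren ρ (≔-unburnt-¬Burnt ¬s) t
    grandchildren (ignite {k} {s = s} {s′} eq _ ρ ρ′) {j} ¬s t with burnt? s′ (f j)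
    ... | inj₂ unburnt-s′ = grandchildren ρ′ (unburnt⇒¬burnt unburnt-s′) t
    ... | inj₁ burnt-s′ with f j ≟ k
    ...   | yes fj≡k = ⊑ˢ-Burnt (run-⊑ ρ′) (children ρ (∈-descending (labels-descending n) (toℕ<n j)) fj≡k)
    ...   | no  fj≢k = ⊑ˢ-Burnt (run-⊑ ρ′) (grandchildren ρ (≔-¬Burnt fj≢k ¬s) burnt-s′)

  rooted⇒all-burnt : ∀ {r t} → Run (treeOracle f) r [] (labels n) (start r) t →
                     ∀ {j} → Rooted f r j → Burnt t j
  rooted⇒all-burnt {r} ρ here = ⊑ˢ-Burnt (run-⊑ ρ) (burnt (at-root (invariant-start r)))
  rooted⇒all-burnt {r} ρ (climb {j} path) with f j ≟ r
  ... | yes fj≡r = children ρ (∈-descending (labels-descending n) (toℕ<n j)) fj≡r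
  ... | no  fj≢r = grandchildren ρ (λ { (burnt eq) → fj≢r (proj₁ (start-burnt r eq)) }) (rooted⇒all-burnt ρ path)

-- Each set of answers determines the other

tally-transfer : ∀ {n} {O : Oracle n} {v σ L s t} z (p : Vec ℕ n) → (∀ j → lookup p j ≡ suc (tally (lookup z j))) →
                 t ⊑ˢ z → Run O v σ L s t → Run (countOracle p) v σ L s t
tally-transfer z p p≡z t⊑z done        = done
tally-transfer z p p≡z t⊑z (skip eq ρ) = skip eq (tally-transfer z p p≡z t⊑z ρ)
tally-transfer z p p≡z t⊑z (resist {j} {s = s} {c = c} eq _ ρ) =
  resist eq (dec-false (lookup p j ℕ.≟ suc c) p≢) (tally-transfer z p p≡z t⊑z ρ)
  where
  -- After this rejection the tally of j is c + 1 and never falls, so the entry of j is at least c +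
  -- 2.
  p≢ : lookup p j ≢ suc c
  p≢ p≡ = ℕ.<⇒≢ (ℕ.≤-trans (ℕ.≤-reflexive (cong tally (sym (lookup∘update j s _))))
                           (⊑⇒tally≤ (at (⊑ˢ-trans (run-⊑ ρ) t⊑z) j)))
                (ℕ.suc-injective (trans (sym p≡) (p≡z j)))
tally-transfer z p p≡z t⊑z (ignite {j} {s = s} {c = c} eq _ ρ ρ′) =
  ignite eq (dec-true (lookup p j ℕ.≟ suc c) (trans (p≡z j) (cong (suc ∘ tally)
      (⊑ˢ-burnt (⊑ˢ-trans (run-⊑ ρ) s′⊑z) (lookup∘update j s _)))))
    (tally-transfer z p p≡z s′⊑z ρ) (tally-transfer z p p≡z t⊑z ρ′)
  where s′⊑z = ⊑ˢ-trans (run-⊑ ρ′) t⊑z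

-- The igniter of a new vertex is either v, going through its list, or a vertex of a nested run,
-- which itself caught fire after `s`. This limits who can ignite a vertex that an earlier run has
-- left unburnt.
newly-burnt : ∀ {n} {O : Oracle n} {v σ L s t} → Run O v σ L s t → ∀ {j c τ} → ¬ Burnt s j → lookup t j ≡ burnt c τ →
              ∃[ x ] ∃[ τ′ ] τ ≡ x ∷ τ′ × (¬ Burnt s x ⊎ (x ≡ v × j ∈ L))
newly-burnt done ¬s eq = contradiction (burnt eq) ¬s
newly-burnt (skip _ ρ) ¬s eq with newly-burnt ρ ¬s eq
... | x , τ′ , τ≡ , inj₁ ¬x          = x , τ′ , τ≡ , inj₁ ¬x
... | x , τ′ , τ≡ , inj₂ (x≡v , j∈L) = x , τ′ , τ≡ , inj₂ (x≡v , there j∈L)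
newly-burnt (resist {s = s} eq-k _ ρ) ¬s eq with newly-burnt ρ (≔-unburnt-¬Burnt ¬s) eq
... | x , τ′ , τ≡ , inj₁ ¬x          = x , τ′ , τ≡ , inj₁ (¬x ∘ ⊑ˢ-Burnt (⊑-≔ {s = s} eq-k (unburnt (ℕ.n≤1+n _))))
... | x , τ′ , τ≡ , inj₂ (x≡v , j∈L) = x , τ′ , τ≡ , inj₂ (x≡v , there j∈L)
newly-burnt {v = v} {σ} (ignite {k} {s = s} {s′} eq-k _ ρ ρ′) {j} ¬s eq with burnt? s′ j
... | inj₂ unburnt-s′ with newly-burnt ρ′ (unburnt⇒¬burnt unburnt-s′) eq
...   | x , τ′ , τ≡ , inj₁ ¬x          =
  x , τ′ , τ≡ , inj₁ (¬x ∘ ⊑ˢ-Burnt (⊑ˢ-trans (⊑-≔ {s = s} eq-k (ignite ℕ.≤-refl)) (run-⊑ ρ)))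
...   | x , τ′ , τ≡ , inj₂ (x≡v , j∈L) = x , τ′ , τ≡ , inj₂ (x≡v , there j∈L)
newly-burnt {v = v} {σ} (ignite {k} {s = s} {s′} eq-k _ ρ ρ′) {j} ¬s eq | inj₁ (burnt eq-s′)
  with refl ← trans (sym (⊑ˢ-burnt (run-⊑ ρ′) eq-s′)) eq with j ≟ k
... | yes refl with refl ← trans (sym (⊑ˢ-burnt (run-⊑ ρ) (lookup∘update k s _))) eq-s′ =
  v , σ , refl , inj₂ (refl , here refl)
... | no j≢k with newly-burnt ρ (≔-¬Burnt j≢k ¬s) eq-s′
...   | x , τ′ , τ≡ , inj₁ ¬x         = x , τ′ , τ≡ , inj₁ (¬x ∘ ⊑ˢ-Burnt (⊑-≔ {s = s} eq-k (ignite ℕ.≤-refl)))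
...   | x , τ′ , τ≡ , inj₂ (refl , _) = x , τ′ , τ≡ , inj₁ (unburnt⇒¬burnt (unburnt eq-k))

Agrees : ∀ {n} → (Fin n → Fin n) → State n → Set
Agrees f s = ∀ {j c x τ} → lookup s j ≡ burnt c (x ∷ τ) → f j ≡ x

agrees-run : ∀ {n f v σ L s t} → Run {n} (treeOracle f) v σ L s t → Agrees f s → Agrees f t
agrees-run done       agrees = agrees
agrees-run (skip _ ρ) agrees = agrees-run ρ agrees
agrees-run {f = f} (resist {k} {s = s} {c = c} _ _ ρ) agrees = agrees-run ρ agrees′
  where
  agrees′ : Agrees f (s [ k ]≔ unburnt (suc c))
  agrees′ {j} eq with ≔-inv s k j eq
  ... | inj₂ (_ , eq′) = agrees eq′
agrees-run {f = f} {v} {σ} (ignite {k} {s = s} {c = c} _ accepted ρ ρ′) agrees = agrees-run ρ′ (agrees-run ρ agrees′)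
  where
  agrees′ : Agrees f (s [ k ]≔ burnt c (v ∷ σ))
  agrees′ {j} eq with ≔-inv s k j eq
  ... | inj₁ (refl , refl) = does-true (f k ≟ v) accepted
  ... | inj₂ (_ , eq′)     = agrees eq′

module _ {n} {O : Oracle n} {f : Fin n → Fin n} (z : State n) (agrees : Agrees f z) where

  private
    -- No vertex left unburnt by a run is ignited later by a vertex that the run has dealt with.
    Finished : Fin n → State n → State n → Set
    Finished v s t = ∀ {j} → ¬ Burnt t j → f j ≢ v × (Burnt t (f j) → Burnt s (f j))

  -- Replays the fire with the parents read off the later state `z`. An accepted label has v as
  -- parent by `agrees`. A label that resists v must have another parent: if it is unburnt at the
  -- end of the run, `Finished` says so; otherwise its igniter is found by `newly-burnt`.
  parent-transfer : ∀ {v σ m L s t} → Descending m L → Burnt s v → t ⊑ˢ z → Finished v s t →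
                    Run O v σ L s t → Run (treeOracle f) v σ L s t
  parent-transfer []         _   _   _        done        = done
  parent-transfer (k≡m ∷ L↓) s-v t⊑z finished (skip eq ρ) = skip eq (parent-transfer L↓ s-v t⊑z finished ρ)
  parent-transfer {v} {t = t} (k≡m ∷ L↓) s-v t⊑z finished (resist {k} {s = s} {c = c} eq _ ρ) =
    resist eq (dec-false (f k ≟ v) fk≢v)
      (parent-transfer L↓ (⊑ˢ-Burnt s⊑s′ s-v) t⊑z
        (λ ¬t → let fj≢v , fj-burnt = finished ¬t in fj≢v , ⊑ˢ-Burnt s⊑s′ ∘ fj-burnt) ρ)
    where
    s⊑s′ : s ⊑ˢ s [ k ]≔ unburnt (suc c)
    s⊑s′ = ⊑-≔ eq (unburnt (ℕ.n≤1+n _))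

    fk≢v : f k ≢ v
    fk≢v with burnt? t k
    ... | inj₂ unburnt-t   = proj₁ (finished (unburnt⇒¬burnt unburnt-t))
    ... | inj₁ (burnt eq-t) with newly-burnt ρ (≔-unburnt-¬Burnt {s = s} (unburnt⇒¬burnt (unburnt eq))) eq-t
    ...   | x , _ , refl , inj₁ ¬x        = λ fk≡v →
      ¬x (subst (Burnt _) (trans (sym fk≡v) (agrees (⊑ˢ-burnt t⊑z eq-t))) (⊑ˢ-Burnt s⊑s′ s-v))
    -- Only labels smaller than k remain on the list of v.
    ...   | x , _ , refl , inj₂ (_ , k∈L) = contradiction (descending-∈ L↓ k∈L) (ℕ.<-irrefl k≡m)
  parent-transfer {v} {σ} {t = t} (k≡m ∷ L↓) s-v t⊑z finished (ignite {k} {s = s} {s′} {c = c} eq _ ρ ρ′) =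
    ignite eq (dec-true (f k ≟ v) (agrees (⊑ˢ-burnt (⊑ˢ-trans (run-⊑ ρ) s′⊑z) (lookup∘update k s _))))
      (parent-transfer (labels-descending n) (burnt (lookup∘update k s _)) s′⊑z finished₁ ρ)
      (parent-transfer L↓ (⊑ˢ-Burnt s⊑s′ s-v) t⊑z
        (λ ¬t → let fj≢v , fj-burnt = finished ¬t in fj≢v , ⊑ˢ-Burnt s⊑s′ ∘ fj-burnt) ρ′)
    where
    s₁ = s [ k ]≔ burnt c (v ∷ σ)

    s⊑s₁ : s ⊑ˢ s₁
    s⊑s₁ = ⊑-≔ eq (ignite ℕ.≤-refl)

    s⊑s′ : s ⊑ˢ s′
    s⊑s′ = ⊑ˢ-trans s⊑s₁ (run-⊑ ρ)

    s′⊑z : s′ ⊑ˢ z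
    s′⊑z = ⊑ˢ-trans (run-⊑ ρ′) t⊑z

    s′-k : Burnt s′ k
    s′-k = ⊑ˢ-Burnt (run-⊑ ρ) (burnt (lookup∘update k s _))

    ¬s-k : ¬ Burnt s k
    ¬s-k = unburnt⇒¬burnt (unburnt eq)

    -- A vertex that the run of k leaves unburnt either stays so until `t`, where `finished`
    -- applies, or burns afterwards, and then its parent is v or a vertex unburnt in `s′`.
    finished₁ : Finished k s₁ s′
    finished₁ {j} ¬s′ with burnt? t j
    ... | inj₂ unburnt-t = let fj≢v , fj-burnt = finished (unburnt⇒¬burnt unburnt-t) in
        (λ fj≡k → ¬s-k (subst (Burnt s) fj≡k (fj-burnt (⊑ˢ-Burnt (run-⊑ ρ′) (subst (Burnt s′) (sym fj≡k) s′-k)))))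
      , ⊑ˢ-Burnt s⊑s₁ ∘ fj-burnt ∘ ⊑ˢ-Burnt (run-⊑ ρ′)
    ... | inj₁ (burnt eq-t) with newly-burnt ρ′ ¬s′ eq-t
    ...   | x , _ , refl , parent rewrite agrees (⊑ˢ-burnt t⊑z eq-t) with parent
    ...     | inj₁ ¬x         = (λ { refl → ¬x s′-k }) , λ s′-x → contradiction s′-x ¬x
    ...     | inj₂ (refl , _) = (λ { refl → ¬s-k s-v }) , λ _ → ⊑ˢ-Burnt s⊑s₁ s-v

-- The largest index with entry 1 and the uprooted condition

module _ {n} {r : Fin n} where

  -- As long as only the root burns, the labels m > r are asked in turn and have not resisted yet.
  private
    Cold : ℕ → State n → Set
    Cold m s = ∀ {j} → j ≢ r → toℕ j < m → lookup s j ≡ unburnt 0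

    cold-resist : ∀ s {k m y} → toℕ k ≡ m → Cold (suc m) s → Cold m (s [ k ]≔ y)
    cold-resist s {y = y} k≡m cold j≢r j<m =
      trans (lookup∘update′ (λ { refl → ℕ.<-irrefl k≡m j<m }) s y) (cold j≢r (ℕ.m<n⇒m<1+n j<m))

    cold-start : ∀ {m} → Cold m (start r)
    cold-start j≢r _ = start-unburnt r j≢r

    cold-¬burnt : ∀ s {k m c τ} → toℕ k ≡ m → Cold (suc m) s → toℕ r < toℕ k → lookup s k ≢ burnt c τ
    cold-¬burnt s k≡m cold r<k eq =
      contradiction (trans (sym (cold (λ { refl → ℕ.<-irrefl refl r<k }) (s≤s (ℕ.≤-reflexive k≡m)))) eq) λ ()

    cold-tally : ∀ s {k m c} → toℕ k ≡ m → Cold (suc m) s → toℕ r < toℕ k → lookup s k ≡ unburnt c → c ≡ 0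
    cold-tally s k≡m cold r<k eq =
      cong tally (trans (sym eq) (cold (λ { refl → ℕ.<-irrefl refl r<k }) (s≤s (ℕ.≤-reflexive k≡m))))

  module _ (p : Vec ℕ n) (r-greatest : ∀ j → lookup p j ≡ 1 → toℕ j ≤ toℕ r) where

    private
      go : ∀ {m L s t} → Descending m L → Cold m s → Burnt s r → Run (countOracle p) r [] L s t →
           ∀ {j c τ} → ¬ Burnt s j → lookup t j ≡ burnt c (r ∷ τ) → toℕ j < toℕ r
      go []         _    _   done ¬s eq = contradiction (burnt eq) ¬s
      go (_∷_ {k} k≡m L↓) cold s-r ρ {j} ¬s eq with toℕ k ℕ.≤? toℕ r
      ... | yes k≤r with newly-burnt ρ ¬s eq
      ...   | _ , _ , refl , inj₁ ¬r = contradiction s-r ¬r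
      ...   | _ , _ , refl , inj₂ (_ , j∈) = ℕ.≤∧≢⇒<
        (ℕ.≤-trans (ℕ.≤-pred (descending-∈ (k≡m ∷ L↓) j∈)) (ℕ.≤-trans (ℕ.≤-reflexive (sym k≡m)) k≤r))
        (λ j≡r → ¬s (subst (Burnt _) (sym (toℕ-injective j≡r)) s-r))
      go {s = s} (_∷_ {k} k≡m L↓) cold s-r (skip eq-k ρ) ¬s eq | no k≰r =
        contradiction eq-k (cold-¬burnt s k≡m cold (ℕ.≰⇒> k≰r))
      go {s = s} (_∷_ {k} k≡m L↓) cold s-r (resist eq-k _ ρ) ¬s eq | no k≰r =
        go L↓ (cold-resist s k≡m cold) (⊑ˢ-Burnt (⊑-≔ eq-k (unburnt (ℕ.n≤1+n _))) s-r) ρ (≔-unburnt-¬Burnt ¬s) eq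
      go {s = s} (_∷_ {k} k≡m L↓) cold s-r (ignite {c = c} eq-k accepted _ _) ¬s eq | no k≰r =
        contradiction (r-greatest k (trans (does-true (lookup p k ℕ.≟ suc c) accepted)
          (cong suc (cold-tally s k≡m cold (ℕ.≰⇒> k≰r) eq-k)))) k≰r

    -- While only the root burns, a label above r has not yet resisted, so it would accept only with
    -- entry 1, which the choice of r excludes. The children of r are thus found among the labels
    -- below r.
    children<root : ∀ {t} → Run (countOracle p) r [] (labels n) (start r) t →
                    ∀ {j c τ} → j ≢ r → lookup t j ≡ burnt c (r ∷ τ) → toℕ j < toℕ r
    children<root ρ j≢r = go (labels-descending n) cold-start (burnt (at-root (invariant-start r))) ρ
      λ { (burnt eq) → j≢r (proj₁ (start-burnt r eq)) }

  module _ (f : Fin n → Fin n) (children-below : ∀ j → j ≢ r → f j ≡ r → toℕ j < toℕ r) where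

    private
      go : ∀ {m L s t} → Descending m L → Cold m s → Run (treeOracle f) r [] L s t →
           ∀ j → toℕ j < m → toℕ r < toℕ j → 1 ≤ tally (lookup t j)
      go (_∷_ {k} k≡m L↓) cold ρ j j<1+m r<j with toℕ k ℕ.≤? toℕ r
      ... | yes k≤r = contradiction
        (ℕ.≤-trans r<j (ℕ.≤-trans (ℕ.≤-pred j<1+m) (ℕ.≤-trans (ℕ.≤-reflexive (sym k≡m)) k≤r)))
        (ℕ.<-irrefl refl)
      go {s = s} (_∷_ {k} k≡m L↓) cold (skip eq-k _) j j<1+m r<j | no k≰r =
        contradiction eq-k (cold-¬burnt s k≡m cold (ℕ.≰⇒> k≰r))
      go (_∷_ {k} k≡m L↓) cold (ignite _ accepted _ _) j j<1+m r<j | no k≰r =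
        contradiction (ℕ.<⇒≤ (children-below k (λ { refl → k≰r ℕ.≤-refl }) (does-true (f k ≟ r) accepted))) k≰r
      go {s = s} (_∷_ {k} {m} k≡m L↓) cold (resist eq-k _ ρ) j j<1+m r<j | no k≰r with j ≟ k
      ... | yes refl = ℕ.≤-trans
        (subst (1 ≤_) (cong tally (sym (lookup∘update k s _))) (s≤s z≤n)) (⊑⇒tally≤ (at (run-⊑ ρ) k))
      ... | no  j≢k  = go L↓ (cold-resist s k≡m cold) ρ j
        (ℕ.≤∧≢⇒< (ℕ.≤-pred j<1+m) λ j≡m → j≢k (toℕ-injective (trans j≡m (sym k≡m)))) r<j

    -- No label above r is a child of r, so each of them resists r when the root asks it.
    tally-above-root : ∀ {t} → Run (treeOracle f) r [] (labels n) (start r) t →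
                       ∀ j → toℕ r < toℕ j → 1 ≤ tally (lookup t j)
    tally-above-root ρ j = go (labels-descending n) cold-start ρ j (toℕ<n j)

-- The tree traced by the fire and the sum formula

module _ {n} {r : Fin n} {t : State n} (I : Invariant r r [] 0 t) (all-burnt : ∀ j → Burnt t j) where

  ancestorMap : AncestorMap n
  ancestorMap = record
    { top    = r
    ; anc    = λ j → ancestors (lookup t j)
    ; anc-r  = cong ancestors (at-root I)
    ; anc-[] = λ {j} eq → only-root I (proj₂ (entry j eq))
    ; anc-∷  = λ {j} eq → cong ancestors (proj₂ (chain I (proj₂ (entry j eq))))
    }
    where
    entry : ∀ j {τ} → ancestors (lookup t j) ≡ τ → ∃[ c ] lookup t j ≡ burnt c τ
    entry j eq with burnt {c} eq′ ← all-burnt j =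
      c , trans eq′ (cong (burnt c) (trans (cong ancestors (sym eq′)) eq))

  #burnt≡n : #burnt t ≡ n
  #burnt≡n = trans (∑ℕ.sum-cong-≗ hot) (∑-one n)
    where
    hot : ∀ j → heat (lookup t j) ≡ 1
    hot j with burnt eq ← all-burnt j = cong heat eq

  -- Away from the root, p_j plus the inversions at j is the weight of j, and the weights add up to
  -- n choose 2. At the root the entry is 1 but the weight is 0, whence the additional 1.
  sum+κ : ∀ p → (∀ j → Obeys (lookup p j) (lookup t j)) →
          Vec.sum p + κ (complete n) (tree ancestorMap) ≡ suc (n C 2)
  sum+κ p obeys =
    trans (cong₂ _+_ (sum≡∑ p) (κ-tree ancestorMap))
    (trans (sym (∑ℕ.∑-distrib-+ (lookup p) (λ j → inversions r j (ancestors (lookup t j)))))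
    (trans (∑-change r pointwise at-r)
           (cong suc (trans (total I) (cong (_C 2) #burnt≡n)))))
    where
    sum≡∑ : ∀ {n} (p : Vec ℕ n) → Vec.sum p ≡ ∑ (lookup p)
    sum≡∑ Vec.[]      = refl
    sum≡∑ (x Vec.∷ p) = cong (_+_ x) (sum≡∑ p)

    pointwise : ∀ j → j ≢ r → lookup p j + inversions r j (ancestors (lookup t j)) ≡ weight r j (lookup t j)
    pointwise j j≢r with lookup t j in eq | obeys j | all-burnt j
    ... | unburnt _       | _   | burnt eq′ = contradiction (trans (sym eq) eq′) λ ()
    ... | burnt _ []      | _   | _         = contradiction (only-root I eq) j≢r
    ... | burnt _ (_ ∷ _) | p≡c | _         = cong (_+ _) p≡c

    at-r : lookup p r + inversions r r (ancestors (lookup t r)) ≡ 1 + weight r r (lookup t r)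
    at-r with lookup t r | at-root I | obeys r
    ... | _ | refl | p≡1 = cong₂ _+_ p≡1 (inversions-[] r r)

-- The bijection

greatest : ∀ {ℓ n} {P : Fin n → Set ℓ} → Decidable P →
           (∃[ i ] P i × (∀ j → P j → toℕ j ≤ toℕ i)) ⊎ (∀ i → ¬ P i)
greatest {n = zero}  P? = inj₂ λ ()
greatest {n = suc n} P? with greatest (P? ∘ suc)
... | inj₁ (i , Pi , max) = inj₁ (suc i , Pi , λ { zero _ → z≤n ; (suc j) Pj → s≤s (max j Pj) })
... | inj₂ none with P? zero
...   | yes P0 = inj₁ (zero , P0 , λ { zero _ → z≤n ; (suc j) Pj → contradiction Pj (none j) })
...   | no ¬P0 = inj₂ λ { zero → ¬P0 ; (suc j) → none j }

-- The data behind the bijection depend on the vector alone, since elements of `sPF` are compared as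
-- vectors.
record Burning {n} (p : Vec ℕ n) : Set where
  field
    r          : Fin n
    p-r        : lookup p r ≡ 1
    r-greatest : ∀ j → lookup p j ≡ 1 → toℕ j ≤ toℕ r
    {final}    : State n
    run        : Run (countOracle p) r [] (labels n) (start r) final
    all-burnt  : ∀ j → Burnt final j
    obeys      : ∀ j → Obeys (lookup p j) (lookup final j)

  invariant : Invariant r r [] 0 final
  invariant = invariant-run r (labels-descending n) (invariant-start r) run

  M : AncestorMap n
  M = ancestorMap invariant all-burnt

  p≡tally : ∀ j → lookup p j ≡ suc (tally (lookup final j))
  p≡tally j with burnt eq ← all-burnt j =
    trans (subst (Obeys (lookup p j)) eq (obeys j)) (cong (suc ∘ tally) (sym eq))

  uprooted : IsUprooted (tree M)
  uprooted i (i≢r , par≡r) with ≢top⇒∷ M i≢r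
  ... | v , σ , eq with burnt {c} eq′ ← all-burnt i = children<root p r-greatest run i≢r (trans eq′
    (cong (burnt c) (trans (cong ancestors (sym eq′)) (trans eq (cong (_∷ σ) (trans (sym (par-tree M eq)) par≡r))))))

  run-parent : Run (treeOracle (parent M)) r [] (labels n) (start r) final
  run-parent = parent-transfer final (λ {j} eq → parent-∷ M (cong ancestors eq)) (labels-descending n)
    (burnt (at-root (invariant-start r))) ⟪ (λ _ → ⊑-refl) ⟫ (λ {j} ¬burnt → contradiction (all-burnt j) ¬burnt) run

open Burning

burning : ∀ {m} {p : Vec ℕ (suc (suc m))} → IsSpherical p → Burning p
burning {m} {p} sph@(positive , not-exceeding) with greatest (λ j → lookup p j ℕ.≟ 1)
... | inj₂ none = contradiction exceeds (not-exceeding A (suc zero , there here) ∣A∣<n)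
  where
  -- If no entry is 1, all are at least 2 = n + 1 - (n - 1), so a set of n - 1 labels contradicts
  -- sphericity; it is nonempty because n ≥ 2.
  A : Subset (suc (suc m))
  A = outside Vec.∷ ⊤

  ∣A∣<n : ∣ A ∣ < suc (suc m)
  ∣A∣<n = s≤s (ℕ.≤-reflexive (∣⊤∣≡n (suc m)))

  exceeds : Exceeds p A
  exceeds i _ = ℕ.≤-trans (ℕ.≤-reflexive (cong (λ a → suc (suc a)) (sym (∣⊤∣≡n (suc m)))))
    (ℕ.+-monoˡ-≤ ∣ A ∣ (ℕ.≤∧≢⇒< (positive i) (none i ∘ sym)))
... | inj₁ (r , p-r , max) with t , ρ ← run-exists {O = countOracle p} r [] (start r) = record
  { r          = r
  ; p-r        = p-r
  ; r-greatest = max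
  ; run        = ρ
  ; all-burnt  = spherical⇒all-burnt p sph p-r ρ
  ; obeys      = obeys-run p ρ (obeys-start p positive p-r)
  }

run-root-cong : ∀ {n} {O O′ : Oracle n} {r r′ t t′} → (∀ v j c → O v j c ≡ O′ v j c) → r ≡ r′ →
                Run O r [] (labels n) (start r) t → Run O′ r′ [] (labels n) (start r′) t′ → t ≡ t′
run-root-cong O≗O′ refl = run-deterministic O≗O′

-- The vector fixes r as the largest index with entry 1, and then the run, which is deterministic.
burning-unique : ∀ {n} {p : Vec ℕ n} (B B′ : Burning p) → tree (M B) ≈ₜ tree (M B′)
burning-unique B B′ = record
  { root-≡ = r≡
  ; adj-≡  = λ u v → cong (λ t → adjacency t u v) (run-root-cong (λ _ _ _ → refl) r≡ (run B) (run B′))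
  }
  where
  adjacency : State _ → Fin _ → Fin _ → Bool
  adjacency t u v = isHead (ancestors (lookup t u)) v ∨ isHead (ancestors (lookup t v)) u

  r≡ : r B ≡ r B′
  r≡ = toℕ-injective (ℕ.≤-antisym (r-greatest B′ (r B) (p-r B)) (r-greatest B (r B′) (p-r B′)))

-- Equal trees have the same root and the same parents, so the runs steered by the parents coincide
-- and leave the same tallies, from which the vectors are read off.
burning-injective : ∀ {n} {p q : Vec ℕ n} (B : Burning p) (B′ : Burning q) → tree (M B) ≈ₜ tree (M B′) → p ≡ q
burning-injective {p = p} {q} B B′ M≈M′ =
  trans (sym (tabulate∘lookup p)) (trans (tabulate-cong λ j → trans (p≡tally B j)
    (trans (cong (λ t → suc (tally (lookup t j))) final≡) (sym (p≡tally B′ j)))) (tabulate∘lookup q))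
  where
  final≡ : final B ≡ final B′
  final≡ = run-root-cong (λ v j _ → cong (λ x → does (x ≟ v)) (tree≈⇒parent≡ (M B) (M B′) M≈M′ j))
    (_≈ₜ_.root-≡ M≈M′) (run-parent B) (run-parent B′)

module _ {n} (T : RootedTree n) where

  private
    treeRun = run-exists {O = treeOracle (par T)} (root T) [] (start (root T))
    z = proj₁ treeRun
    ρ = proj₂ treeRun

  -- The inverse map: one more than the number of resistances in the fire steered by `T`, because
  -- `countOracle` accepts at tally p_j - 1.
  parkingFunction : Vec ℕ n
  parkingFunction = Vec.map (suc ∘ tally) z

  private
    p≡ : ∀ j → lookup parkingFunction j ≡ suc (tally (lookup z j))
    p≡ j = lookup-map j (suc ∘ tally) z

    countRun : Run (countOracle parkingFunction) (root T) [] (labels n) (start (root T)) z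
    countRun = tally-transfer z parkingFunction p≡ ⟪ (λ _ → ⊑-refl) ⟫ ρ

    p-root : lookup parkingFunction (root T) ≡ 1
    p-root = trans (p≡ (root T)) (cong (suc ∘ tally) (⊑ˢ-burnt (run-⊑ ρ) (at-root (invariant-start (root T)))))

  parkingFunction-spherical : IsSpherical parkingFunction
  parkingFunction-spherical = all-burnt⇒spherical parkingFunction countRun (λ j → rooted⇒all-burnt ρ (rooted T j))
    (λ j → subst (1 ≤_) (sym (p≡ j)) (s≤s z≤n)) p-root

  -- The root of `T` has entry 1 and, as `T` is uprooted, every larger label resists it and has
  -- entry at least 2; so both fires start at the same vertex. The counting run then retraces the
  -- run steered by `T`, which ignites vertices from their parents in `T`.
  burning-parkingFunction : IsUprooted T → (B : Burning parkingFunction) → tree (M B) ≈ₜ T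
  burning-parkingFunction T-uprooted B = tree≈ (M B) T r≡root parents
    where
    r≡root : r B ≡ root T
    r≡root with ℕ.m≤n⇒m<n∨m≡n (r-greatest B (root T) p-root)
    ... | inj₂ root≡r = toℕ-injective (sym root≡r)
    ... | inj₁ root<r = contradiction
      (tally-above-root (par T) (λ j j≢root par≡root → T-uprooted j (j≢root , par≡root)) ρ (r B) root<r)
      (subst (λ c → ¬ 1 ≤ c) (ℕ.suc-injective (trans (sym (p-r B)) (p≡ (r B)))) λ ())

    final≡z : final B ≡ z
    final≡z = run-root-cong (λ _ _ _ → refl) r≡root (run B) countRun

    parents : ∀ {j v σ} → anc (M B) j ≡ v ∷ σ → par T j ≡ v
    parents {j} eq with burnt {c} eq′ ← all-burnt B j =
      agrees-run {f = par T} ρ (λ eq-start → contradiction (proj₂ (start-burnt (root T) eq-start)) λ ())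
        (trans (cong (λ t → lookup t j) (sym final≡z))
          (trans eq′ (cong (burnt c) (trans (cong ancestors (sym eq′)) eq))))

theorem2p9 : ∀ {c ℓ₁ ℓ₂} (K : HeytingField c ℓ₁ ℓ₂) (n : ℕ) → 2 ≤ n →
    Σ[ φ ∈ Bijection (sPF K (complete (suc n))) (𝓤 n) ]
    (∀ P → + sumPF K (complete (suc n)) P
    ≡ + (n C 2) ℤ.- + κ (complete n) (proj₁ (Bijection.to φ P)) ℤ.+ + 1)
theorem2p9 K (suc (suc m)) (s≤s (s≤s z≤n)) =
  φ , λ P → integer-form (sum+κ (invariant (B P)) (all-burnt (B P)) (proj₁ P) (obeys (B P)))
  where
  n = suc (suc m)

  B : (P : Σ[ p ∈ Vec ℕ n ] IsSphericalPF K (complete (suc n)) p) → Burning (proj₁ P)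
  B (p , sph) = burning (IsSphericalPF⇒IsSpherical K p sph)

  φ : Bijection (sPF K (complete (suc n))) (𝓤 n)
  φ = record
    { to        = λ P → tree (M (B P)) , uprooted (B P)
    ; cong      = λ { {P} {Q} refl → burning-unique (B P) (B Q) }
    ; bijective = (λ {P} {Q} → burning-injective (B P) (B Q))
                , λ (T , T-uprooted) →
                    (parkingFunction T
                    , IsSpherical⇒IsSphericalPF K (parkingFunction T) (parkingFunction-spherical T))
                  -- `Q` has the same vector but an arbitrary proof of membership.
                  , λ { {Q} refl → burning-parkingFunction T T-uprooted (B Q) }
    }

  integer-form : ∀ {a k b} → a + k ≡ suc b → + a ≡ + b ℤ.- + k ℤ.+ + 1
  integer-form {a} {k} {b} eq = sym (begin
    + b ℤ.- + k ℤ.+ + 1   ≡⟨ ℤ.+-comm (+ b ℤ.- + k) (+ 1) ⟩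
    + 1 ℤ.+ (+ b ℤ.- + k) ≡⟨ ℤ.+-assoc (+ 1) (+ b) (ℤ.- + k) ⟨
    + suc b ℤ.- + k       ≡⟨ cong (λ x → + x ℤ.- + k) eq ⟨
    + a ℤ.+ + k ℤ.- + k   ≡⟨ ℤ.+-assoc (+ a) (+ k) (ℤ.- + k) ⟩
    + a ℤ.+ (+ k ℤ.- + k) ≡⟨ cong (λ x → + a ℤ.+ x) (ℤ.+-inverseʳ (+ k)) ⟩
    + a ℤ.+ + 0           ≡⟨ ℤ.+-identityʳ (+ a) ⟩
    + a                   ∎)
    where open ≡-Reasoning
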